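{- Let $m\ge 3$, $n\ge 3$, let $F_n(K_m)$ be a complete flower graph with set of associated vertices $I$, and let $u$ and $v$ be vertices of $F_n(K_m)$. Then $$r_{F_n(K_m)}(u,v)=\frac{2d(n-d)}{mn}\quad\text{if both } u,v\in I,$$ $$r_{F_n(K_m)}(u,v)=\frac{2d}{m}-\frac{(2d-1)^2}{2mn}\quad\text{if one of } u,v \text{ is in } I,$$ $$r_{F_n(K_m)}(u,v)=\frac{2d}{m}-\frac{2(d-1)^2}{mn}\quad\text{if neither } u \text{ nor } v \text{ is in } I,$$ where $d$ is the number of flower petals separating $u$ and $v$, including the petals containing $u$ and $v$.
   Context: For a connected graph $H$ with vertex set $\{1,\dots,N\}$ and Laplacian matrix $L$, the resistance distance between vertices $i,j$ is $r_H(i,j)=(e_i-e_j)^T L^\dagger (e_i-e_j)$, where $e_i$ is the $i$th standard unit vector and $L^\dagger$ is the Moore–Penrose pseudoinverse of $L$. Complete flower graph: for $m\ge3$ and $n\ge 3$, let $x,y$ be two arbitrary distinct vertices of the complete graph $K_m$. $F_n(K_m)$ is obtained from $n$ vertex-disjoint copies $G_1,\dots,G_n$ of $K_m$, with $x_i,y_i$ the copies of $x,y$ in $G_i$, by identifying $x_{i-1}$ with $y_i$ for $1<i\le n$ and $x_n$ with $y_1$. The copies $G_i$ are called the petals of the flower graph, and $I=\{x_1,\dots,x_n\}$ is the set of associated vertices, i.e. the vertices connecting the copies of $K_m$.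
   Formalization: In the third case (neither u nor v in I) the vertices u and v are assumed distinct, because for u = v the resistance distance is 0 while the printed formula gives 2/m (with d = 1). -}

module Defs where

open import Algebra.Bundles using (CommutativeRing)
open import Data.Bool.Base using (if_then_else_)
open import Data.Fin.Base using (Fin; zero; suc; toℕ; fromℕ; inject₁; combine; punchOut)
open import Data.Fin.Properties using (_≟_; any?; nonZeroIndex)
open import Data.Nat.Base as ℕ using (ℕ; suc)
open import Data.Nat.DivMod using (_%_)
open import Data.Product using (∃-syntax; _×_; _,_; proj₁)
open import Data.Rational using (ℚ; 0ℚ; 1ℚ; _*_; _-_)
open import Data.Rational.Properties using (+-*-commutativeRing)
open import Data.Sum using (_⊎_)
open import Data.Vec.Functional using (Vector)
open import Function using (_∘_)
open import Level using (0ℓ)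
open import Relation.Binary using (Rel; Decidable; Symmetric; Irreflexive)
open import Relation.Binary.PropositionalEquality using (_≡_; _≢_; refl; sym; ≢-sym)
open import Relation.Nullary using (does; yes; no; ¬?; _×-dec_)

open import Algebra.Properties.Semiring.Sum
  (CommutativeRing.semiring +-*-commutativeRing) using (sum) public

-- Laplacians have integer entries, and the Moore–Penrose pseudoinverse of a
-- rational matrix is rational, so ℚ loses nothing compared with ℝ.
Matrix : ℕ → ℕ → Set
Matrix p q = Vector (Vector ℚ q) p

infixl 7 _·_
_·_ : ∀ {p q r} → Matrix p q → Matrix q r → Matrix p r
(A · B) i k = sum (λ j → A i j * B j k)

infix 8 _ᵀ
_ᵀ : ∀ {p q} → Matrix p q → Matrix q p
(A ᵀ) i j = A j i

infix 4 _≋_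
_≋_ : ∀ {p q} → Rel (Matrix p q) 0ℓ
A ≋ B = ∀ i j → A i j ≡ B i j

-- The Penrose equations determine A† uniquely.
record IsMoorePenrose {p q} (A : Matrix p q) (A† : Matrix q p) : Set where
  field
    AA†A≋A     : A · A† · A ≋ A
    A†AA†≋A†   : A† · A · A† ≋ A†
    AA†-sym    : (A · A†) ᵀ ≋ A · A†
    A†A-sym    : (A† · A) ᵀ ≋ A† · A

record Graph (N : ℕ) : Set₁ where
  field
    Adj    : Rel (Fin N) 0ℓ
    Adj?   : Decidable Adj
    symm   : Symmetric Adj
    irrefl : Irreflexive _≡_ Adj

δ : ∀ {N} → Fin N → Fin N → ℚ
δ i j = if does (i ≟ j) then 1ℚ else 0ℚ

module _ {N} (H : Graph N) where
  open Graph H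

  adjacency : Matrix N N
  adjacency i j = if does (Adj? i j) then 1ℚ else 0ℚ

  degree : Fin N → ℚ
  degree i = sum (adjacency i)

  laplacian : Matrix N N
  laplacian i j = degree i * δ i j - adjacency i j

  -- r = (eᵢ − eⱼ)ᵀ L† (eᵢ − eⱼ), where δ i is the standard unit vector eᵢ.
  -- Since L† is unique, this relation determines r.
  IsResistanceDistance : Fin N → Fin N → ℚ → Set
  IsResistanceDistance i j r =
    ∃[ L† ] IsMoorePenrose laplacian L† ×
            r ≡ sum (λ k → sum (λ l → (δ i k - δ j k) * L† k l * (δ i l - δ j l)))

complete : ∀ m → Graph m
complete m = record
  { Adj    = _≢_
  ; Adj?   = λ i j → ¬? (i ≟ j)
  ; symm   = ≢-sym
  ; irrefl = λ i≡j i≢j → i≢j i≡j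
  }

prev : ∀ {n} → Fin n → Fin n
prev zero    = fromℕ _
prev (suc i) = inject₁ i

-- The number of terms in the cyclic sequence s, s+1, …, t of petals (indices
-- modulo n); it lies between 1 and n.
petalCount : ∀ {n} → Fin n → Fin n → ℕ
petalCount {n} s t = suc (_%_ (toℕ t ℕ.+ n ℕ.∸ toℕ s) n ⦃ nonZeroIndex s ⦄)

module Flower {m} (G : Graph m) (n : ℕ) (x y : Fin m) (x≢y : x ≢ y) where

  -- Each identified pair xᵢ₋₁ = yᵢ is represented by xᵢ₋₁, so a vertex is a
  -- pair of a petal i and a vertex of G other than y, encoded by `combine`.
  Vertex : Set
  Vertex = Fin (n ℕ.* ℕ.pred m)

  represent : ∀ {m} (y k : Fin m) → y ≢ k → Fin (ℕ.pred m)
  represent {suc _} _ _ y≢k = punchOut y≢k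

  -- glue i k is the vertex of the flower that the copy of k in petal i becomes.
  glue : Fin n → Fin m → Vertex
  glue i k with y ≟ k
  ... | yes _   = combine (prev i) (represent y x (≢-sym x≢y))
  ... | no  y≢k = combine i (represent y k y≢k)

  FlowerAdj : Rel Vertex 0ℓ
  FlowerAdj u v = u ≢ v × ∃[ i ] ∃[ k ] ∃[ l ] Graph.Adj G k l × glue i k ≡ u × glue i l ≡ v

  -- The condition u ≢ v in FlowerAdj is redundant for n ≥ 2; for n = 1 the
  -- gluing could create a loop.
  flower : Graph (n ℕ.* ℕ.pred m)
  flower = record
    { Adj    = FlowerAdj
    ; Adj?   = λ u v → ¬? (u ≟ v) ×-dec any? λ i → any? λ k → any? λ l →
                 Graph.Adj? G k l ×-dec (glue i k ≟ u ×-dec glue i l ≟ v)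
    ; symm   = λ (u≢v , i , k , l , kl , p , q) →
                 ≢-sym u≢v , i , l , k , Graph.symm G kl , q , p
    ; irrefl = λ u≡v uv → proj₁ uv u≡v
    }

  Associated : Vertex → Set
  Associated u = ∃[ i ] glue i x ≡ u

  -- Going round the flower from u to v in the direction of increasing petal
  -- index traverses d petals.  An associated vertex u = xᵢ₋₁ = yᵢ is left
  -- through petal i, in which it is not the copy of x; an associated vertex
  -- v = xⱼ = yⱼ₊₁ is reached through petal j, in which it is not the copy of y.
  Arc : Vertex → Vertex → ℕ → Set
  Arc u v d = ∃[ s ] ∃[ t ] (∃[ k ] k ≢ x × glue s k ≡ u)
                          × (∃[ l ] l ≢ y × glue t l ≡ v)
                          × d ≡ petalCount s t

  -- The number of petals separating u and v, including those containing them,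
  -- may be counted either way round the flower; no petal separates u from u.
  Separating : Vertex → Vertex → ℕ → Set
  Separating u v d = (u ≡ v × d ≡ 0) ⊎ Arc u v d ⊎ Arc v u d

{-# OPTIONS --safe #-}
module Submission where

-- As an electrical network, Kₘ with unit resistors is equivalent to a star whose m
-- legs have resistance 1/m.  The flower thus becomes a cycle of 2n edges of resistance
-- 1/m, whose even positions are the associated vertices and whose odd positions are the
-- centres of the petals, with each remaining vertex pending from a centre.  Grounding
-- the associated vertex at position 0 = 2n leaves a segment with both ends grounded, and
-- its Green's function min(p, q) − pq/(2n) yields an explicit matrix Y with
-- L Y = I − e 1ᵀ, e being the unit vector of the grounded vertex.  Centring the rows and
-- columns of Y produces the Moore–Penrose inverse of L, and centring does not affect
-- (eᵤ − eᵥ)ᵀ Y (eᵤ − eᵥ).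

open import Defs
open import Algebra.Bundles using (CommutativeRing)
import Algebra.Properties.Semiring.Sum as Sum
open import Data.Bool.Base using (if_then_else_)
open import Data.Fin.Base using (Fin; zero; suc; toℕ; fromℕ; inject₁; combine; remQuot; punchIn; punchOut)
open import Data.Fin.Properties as Fin using (_≟_; any?)
open import Data.Fin.Relation.Unary.Top using (view; ‵fromℕ; ‵inject₁)
open import Data.Integer.Base as ℤ using (ℤ; +_)
import Data.Integer.Properties as ℤ
open import Data.Nat.Base as ℕ using (ℕ; zero; suc; NonZero; _≤_; z≤n; s≤s; _⊓_)
open import Data.Nat.DivMod using (_%_; [m+n]%n≡m%n; m<n⇒m%n≡m)
open import Data.Nat.Properties as ℕ using (m*n≢0)
import Data.Nat.Solver as ℕSolver
open import Data.Product using (_×_; _,_; proj₁; proj₂; ∃-syntax)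
open import Data.Rational using (ℚ; 0ℚ; 1ℚ; _+_; _*_; _-_; -_; _/_; toℚᵘ)
open import Data.Rational.Properties as ℚ using (+-*-commutativeRing)
open import Data.Rational.Solver using (module +-*-Solver)
import Data.Rational.Unnormalised as ℚᵘ
import Data.Rational.Unnormalised.Properties as ℚᵘ
open import Data.Sum as ⊎ using (_⊎_; inj₁; inj₂)
open import Function using (_∘_; _$_; case_of_)
open import Relation.Binary.PropositionalEquality
open import Relation.Nullary using (¬_; Dec; does; yes; no; ¬?; _×-dec_; _⊎-dec_; contradiction)
open import Relation.Nullary.Decidable using (dec-true; dec-false)

open +-*-Solver
open Sum (CommutativeRing.semiring +-*-commutativeRing)
  using (sum-cong-≗; sum-replicate-zero; ∑-distrib-+; ∑-comm; *-distribˡ-sum; *-distribʳ-sum)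
open ≡-Reasoning

-- At potentials f, the clique Kₘ draws the current m f(k) - Σ f = m (f(k) - mean f) from its vertex
-- k. This is the current in a leg of resistance 1/m whose other end floats at the mean: hence the
-- star. Its centres are not vertices of the flower and occur only through the values of `G` at odd
-- positions. The closed formulas come from arcs of D and 2n - D edges in parallel, (D - D²/(2n))/m,
-- plus 1/m for each end that is not associated; D is 2d, 2d - 1 or 2d - 2 for zero, one or two such
-- ends. The difficulty is the gluing. An associated vertex has two names, as a copy of `x` in one
-- petal and of `y` in the next. So potentials are compared through values of `G` instead of
-- positions, and the Laplacian is computed as a sum over petals and names instead of vertices. Such
-- a sum is correct only if no edge lies in two petals; for n = 2 the edge joining the two
-- associated vertices would, and this is where n ≥ 3 enters.

-- Integers and reciprocals inside the rationals.

toℚᵘ-/ : ∀ z n .{{_ : NonZero n}} → toℚᵘ (z / n) ℚᵘ.≃ (z ℚᵘ./ n)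
toℚᵘ-/ z (suc n) = ℚ.toℚᵘ-fromℚᵘ (ℚᵘ.mkℚᵘ z n)

opaque
  -- Opaque, so that `ι z` stays an atom instead of unfolding into the gcd normalisation behind
  -- `_/_`.
  ι : ℤ → ℚ
  ι z = z / 1

  ι-+ : ∀ a b → ι (a ℤ.+ b) ≡ ι a + ι b
  ι-+ a b = ℚ.toℚᵘ-injective (ℚᵘ.≃-trans (toℚᵘ-/ (a ℤ.+ b) 1) (ℚᵘ.≃-sym
    (ℚᵘ.≃-trans (ℚ.toℚᵘ-homo-+ (ι a) (ι b)) (ℚᵘ.≃-trans (ℚᵘ.+-cong (toℚᵘ-/ a 1) (toℚᵘ-/ b 1))
    (ℚᵘ.*≡* (cong (ℤ._* + 1) (cong₂ ℤ._+_ (ℤ.*-identityʳ a) (ℤ.*-identityʳ b))))))))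

  ι-* : ∀ a b → ι (a ℤ.* b) ≡ ι a * ι b
  ι-* a b = ℚ.toℚᵘ-injective (ℚᵘ.≃-trans (toℚᵘ-/ (a ℤ.* b) 1) (ℚᵘ.≃-sym
    (ℚᵘ.≃-trans (ℚ.toℚᵘ-homo-* (ι a) (ι b)) (ℚᵘ.*-cong (toℚᵘ-/ a 1) (toℚᵘ-/ b 1)))))

  ι-neg : ∀ a → ι (ℤ.- a) ≡ - ι a
  ι-neg a = begin
    ι (ℤ.- a)                     ≡⟨ solve 2 (λ x y → x := (x :+ y) :- y) refl (ι (ℤ.- a)) (ι a) ⟩
    (ι (ℤ.- a) + ι a) - ι a       ≡⟨ cong (_- ι a) (ι-+ (ℤ.- a) a) ⟨
    ι (ℤ.- a ℤ.+ a) - ι a         ≡⟨ cong (λ z → ι z - ι a) (ℤ.+-inverseˡ a) ⟩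
    0ℚ - ι a                      ≡⟨ ℚ.+-identityˡ (- ι a) ⟩
    - ι a                         ∎

  -- Confines division to reciprocals, which the ring solver can treat as variables.
  /-as-* : ∀ z n .{{_ : NonZero n}} → z / n ≡ ι z * (+ 1 / n)
  /-as-* z n@(suc _) = ℚ.toℚᵘ-injective (ℚᵘ.≃-trans (toℚᵘ-/ z n) (ℚᵘ.≃-sym
    (ℚᵘ.≃-trans (ℚ.toℚᵘ-homo-* (ι z) (+ 1 / n)) (ℚᵘ.≃-trans (ℚᵘ.*-cong (toℚᵘ-/ z 1) (toℚᵘ-/ (+ 1) n))
    (ℚᵘ.*≡* (cong₂ ℤ._*_ (ℤ.*-identityʳ z) (cong +_ (sym (ℕ.*-identityˡ n)))))))))

  n*1/n≡1 : ∀ n .{{_ : NonZero n}} → ι (+ n) * (+ 1 / n) ≡ 1ℚ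
  n*1/n≡1 n@(suc _) = trans (sym (/-as-* (+ n) n)) (ℚ.toℚᵘ-injective (ℚᵘ.≃-trans (toℚᵘ-/ (+ n) n)
    (ℚᵘ.*≡* (ℤ.*-comm (+ n) (+ 1)))))

  ι-0 : ι (+ 0) ≡ 0ℚ
  ι-0 = refl

  ι-1 : ι (+ 1) ≡ 1ℚ
  ι-1 = refl

-- Indicators and finite sums.

ind : ∀ {p} {P : Set p} → Dec P → ℚ
ind P? = if does P? then 1ℚ else 0ℚ

ind-yes : ∀ {p} {P : Set p} (P? : Dec P) → P → ind P? ≡ 1ℚ
ind-yes P? p = cong (if_then 1ℚ else 0ℚ) (dec-true P? p)

ind-no : ∀ {p} {P : Set p} (P? : Dec P) → ¬ P → ind P? ≡ 0ℚ
ind-no P? ¬p = cong (if_then 1ℚ else 0ℚ) (dec-false P? ¬p)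

ind-cong : ∀ {p q} {P : Set p} {Q : Set q} (P? : Dec P) (Q? : Dec Q) →
           (P → Q) → (Q → P) → ind P? ≡ ind Q?
ind-cong (yes p) Q? f g = sym (ind-yes Q? (f p))
ind-cong (no ¬p) Q? f g = sym (ind-no Q? (¬p ∘ g))

δ-sym : ∀ {N} (i j : Fin N) → δ i j ≡ δ j i
δ-sym i j = ind-cong (i ≟ j) (j ≟ i) sym sym

sum-zero : ∀ {N} {f : Fin N → ℚ} → (∀ i → f i ≡ 0ℚ) → sum f ≡ 0ℚ
sum-zero {N} f≗0 = trans (sum-cong-≗ f≗0) (sum-replicate-zero N)

sum-δ : ∀ {N} (i : Fin N) (f : Fin N → ℚ) → sum (λ k → δ i k * f k) ≡ f i
sum-δ zero    f = trans (cong₂ _+_ (ℚ.*-identityˡ (f zero)) (sum-zero (λ k → ℚ.*-zeroˡ (f (suc k)))))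
                        (ℚ.+-identityʳ (f zero))
sum-δ (suc i) f = trans (cong₂ _+_ (ℚ.*-zeroˡ (f zero)) (sum-δ i (f ∘ suc))) (ℚ.+-identityˡ (f (suc i)))

sum-δ₁ : ∀ {N} (i : Fin N) → sum (δ i) ≡ 1ℚ
sum-δ₁ i = trans (sum-cong-≗ (λ k → sym (ℚ.*-identityʳ (δ i k)))) (sum-δ i (λ _ → 1ℚ))

∑-distrib-- : ∀ {N} (f g : Fin N → ℚ) → sum (λ k → f k - g k) ≡ sum f - sum g
∑-distrib-- f g = begin
  sum (λ k → f k - g k)
    ≡⟨ solve 2 (λ x y → x := (x :+ y) :- y) refl (sum (λ k → f k - g k)) (sum g) ⟩
  (sum (λ k → f k - g k) + sum g) - sum g  ≡⟨ cong (_- sum g) (∑-distrib-+ (λ k → f k - g k) g) ⟨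
  sum (λ k → (f k - g k) + g k) - sum g
    ≡⟨ cong (_- sum g) (sum-cong-≗ (λ k → solve 2 (λ x y → (x :- y) :+ y := x) refl (f k) (g k))) ⟩
  sum f - sum g                            ∎

sum-const : ∀ N x → sum {N} (λ _ → x) ≡ ι (+ N) * x
sum-const zero    x = sym (trans (cong (_* x) ι-0) (ℚ.*-zeroˡ x))
sum-const (suc N) x = begin
  x + sum {N} (λ _ → x)  ≡⟨ cong (λ s → x + s) (sum-const N x) ⟩
  x + ι (+ N) * x        ≡⟨ solve 2 (λ x n → x :+ n :* x := (con 1ℚ :+ n) :* x) refl x (ι (+ N)) ⟩
  (1ℚ + ι (+ N)) * x     ≡⟨ cong (_* x) (trans (ι-+ (+ 1) (+ N)) (cong (_+ ι (+ N)) ι-1)) ⟨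
  ι (+ suc N) * x        ∎

sum-δ-δ : ∀ {N} (i j : Fin N) (f : Fin N → ℚ) → sum (λ k → (δ i k - δ j k) * f k) ≡ f i - f j
sum-δ-δ i j f = begin
  sum (λ k → (δ i k - δ j k) * f k)
    ≡⟨ sum-cong-≗ (λ k → solve 3 (λ a b c → (a :- b) :* c := a :* c :- b :* c) refl (δ i k) (δ j k) (f k)) ⟩
  sum (λ k → δ i k * f k - δ j k * f k)                  ≡⟨ ∑-distrib-- (λ k → δ i k * f k) (λ k → δ j k * f k) ⟩
  sum (λ k → δ i k * f k) - sum (λ k → δ j k * f k)      ≡⟨ cong₂ _-_ (sum-δ i f) (sum-δ j f) ⟩
  f i - f j                                              ∎

-- The Moore-Penrose inverse by centring.

module MoorePenrose {N : ℕ} .{{_ : NonZero N}} (L Y : Matrix N N) (c : Fin N → ℚ)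
  (L-sym : ∀ i j → L i j ≡ L j i) (L-rows : ∀ i → sum (L i) ≡ 0ℚ)
  (Y-sym : ∀ i j → Y i j ≡ Y j i) (LY : ∀ i j → (L · Y) i j ≡ δ i j - c i) where

  N⁻¹ : ℚ
  N⁻¹ = + 1 / N

  mean : (Fin N → ℚ) → ℚ
  mean f = sum f * N⁻¹

  sum-const-mean : ∀ f → sum {N} (λ _ → mean f) ≡ sum f
  sum-const-mean f = begin
    sum {N} (λ _ → mean f)       ≡⟨ sum-const N (mean f) ⟩
    ι (+ N) * (sum f * N⁻¹)      ≡⟨ solve 3 (λ n s r → n :* (s :* r) := s :* (n :* r)) refl (ι (+ N)) (sum f) N⁻¹ ⟩
    sum f * (ι (+ N) * N⁻¹)      ≡⟨ cong (sum f *_) (n*1/n≡1 N) ⟩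
    sum f * 1ℚ                   ≡⟨ ℚ.*-identityʳ _ ⟩
    sum f                        ∎

  a : Fin N → ℚ
  a i = mean (Y i)

  b : ℚ
  b = mean a

  -- X = P Y P with P = I − J/N, where J is the all-ones matrix.
  X : Matrix N N
  X i j = Y i j - a i - a j + b

  X-sym : ∀ i j → X i j ≡ X j i
  X-sym i j = trans (cong (λ y → y - a i - a j + b) (Y-sym i j))
    (solve 4 (λ y p q r → y :- p :- q :+ r := y :- q :- p :+ r) refl (Y j i) (a i) (a j) b)

  X-rows : ∀ i → sum (X i) ≡ 0ℚ
  X-rows i = begin
    sum (X i)
      ≡⟨ ∑-distrib-+ (λ j → Y i j - a i - a j) (λ _ → b) ⟩
    sum (λ j → Y i j - a i - a j) + sum {N} (λ _ → b)
      ≡⟨ cong₂ _+_ (∑-distrib-- (λ j → Y i j - a i) a) (sum-const-mean a) ⟩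
    sum (λ j → Y i j - a i) - sum a + sum a
      ≡⟨ cong (λ s → s - sum a + sum a) (trans (∑-distrib-- (Y i) (λ _ → a i)) (cong (λ s → sum (Y i) - s) (sum-const-mean (Y i)))) ⟩
    sum (Y i) - sum (Y i) - sum a + sum a
      ≡⟨ solve 2 (λ s t → s :- s :- t :+ t := con 0ℚ) refl (sum (Y i)) (sum a) ⟩
    0ℚ ∎

  -- Row `i` of `L · Y` sums to 1 - N c(i). The resulting `c i` cancels the one in `LY`, so that
  -- `LX` no longer depends on which vertex is grounded.
  L-a : ∀ i → sum (λ k → L i k * a k) ≡ N⁻¹ - c i
  L-a i = begin
    sum (λ k → L i k * (sum (Y k) * N⁻¹))
      ≡⟨ sum-cong-≗ (λ k → trans (sym (ℚ.*-assoc (L i k) (sum (Y k)) N⁻¹)) (cong (_* N⁻¹) (*-distribˡ-sum (L i k) (Y k)))) ⟩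
    sum (λ k → sum (λ l → L i k * Y k l) * N⁻¹)
      ≡⟨ *-distribʳ-sum N⁻¹ (λ k → sum (λ l → L i k * Y k l)) ⟨
    sum (λ k → sum (λ l → L i k * Y k l)) * N⁻¹
      ≡⟨ cong (_* N⁻¹) (∑-comm (λ k l → L i k * Y k l)) ⟩
    sum ((L · Y) i) * N⁻¹
      ≡⟨ cong (_* N⁻¹) (trans (sum-cong-≗ (LY i)) (∑-distrib-- (δ i) (λ _ → c i))) ⟩
    (sum (δ i) - sum {N} (λ _ → c i)) * N⁻¹
      ≡⟨ cong (_* N⁻¹) (cong₂ _-_ (sum-δ₁ i) (sum-const N (c i))) ⟩
    (1ℚ - ι (+ N) * c i) * N⁻¹
      ≡⟨ solve 3 (λ n x r → (con 1ℚ :- n :* x) :* r := r :- (n :* r) :* x) refl (ι (+ N)) (c i) N⁻¹ ⟩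
    N⁻¹ - (ι (+ N) * N⁻¹) * c i
      ≡⟨ cong (λ s → N⁻¹ - s * c i) (n*1/n≡1 N) ⟩
    N⁻¹ - 1ℚ * c i
      ≡⟨ cong (λ s → N⁻¹ - s) (ℚ.*-identityˡ (c i)) ⟩
    N⁻¹ - c i ∎

  LX : ∀ i j → (L · X) i j ≡ δ i j - N⁻¹
  LX i j = begin
    sum (λ k → L i k * (Y k j - a k - a j + b))
      -- The part `a j - b` is constant in `k`, so the zero row sums of `L` annihilate it.
      ≡⟨ sum-cong-≗ (λ k → solve 5 (λ l y p q r → l :* (y :- p :- q :+ r) := l :* y :- l :* p :- l :* (q :- r))
           refl (L i k) (Y k j) (a k) (a j) b) ⟩
    sum (λ k → L i k * Y k j - L i k * a k - L i k * (a j - b))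
      ≡⟨ trans (∑-distrib-- (λ k → L i k * Y k j - L i k * a k) _)
           (cong (_- sum (λ k → L i k * (a j - b))) (∑-distrib-- (λ k → L i k * Y k j) (λ k → L i k * a k))) ⟩
    (L · Y) i j - sum (λ k → L i k * a k) - sum (λ k → L i k * (a j - b))
      ≡⟨ cong₂ _-_ (cong₂ _-_ (LY i j) (L-a i)) (trans (sym (*-distribʳ-sum (a j - b) (L i))) (cong (_* (a j - b)) (L-rows i))) ⟩
    (δ i j - c i) - (N⁻¹ - c i) - 0ℚ * (a j - b)
      ≡⟨ solve 4 (λ d x r q → (d :- x) :- (r :- x) :- con 0ℚ :* q := d :- r) refl (δ i j) (c i) N⁻¹ (a j - b) ⟩
    δ i j - N⁻¹ ∎

  XL : ∀ i j → (X · L) i j ≡ δ i j - N⁻¹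
  XL i j = begin
    sum (λ k → X i k * L k j)
      ≡⟨ sum-cong-≗ (λ k → trans (cong₂ _*_ (X-sym i k) (L-sym k j)) (ℚ.*-comm (X k i) (L j k))) ⟩
    (L · X) j i                ≡⟨ LX j i ⟩
    δ j i - N⁻¹                ≡⟨ cong (_- N⁻¹) (δ-sym j i) ⟩
    δ i j - N⁻¹                ∎

  -- Symmetry turns the zero row sums of `M` into zero column sums, so the term with `N⁻¹` vanishes.
  -- Applied to `L` and to `X`, this gives the first two Penrose equations.
  centering : (M : Matrix N N) → (∀ i j → M i j ≡ M j i) → (∀ i → sum (M i) ≡ 0ℚ) →
              ∀ i j → sum (λ k → (δ i k - N⁻¹) * M k j) ≡ M i j
  centering M M-sym M-rows i j = begin
    sum (λ k → (δ i k - N⁻¹) * M k j)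
      ≡⟨ sum-cong-≗ (λ k → solve 3 (λ d r x → (d :- r) :* x := d :* x :- r :* x) refl (δ i k) N⁻¹ (M k j)) ⟩
    sum (λ k → δ i k * M k j - N⁻¹ * M k j)
      ≡⟨ ∑-distrib-- (λ k → δ i k * M k j) (λ k → N⁻¹ * M k j) ⟩
    sum (λ k → δ i k * M k j) - sum (λ k → N⁻¹ * M k j)
      ≡⟨ cong₂ _-_ (sum-δ i (λ k → M k j)) (sym (*-distribˡ-sum N⁻¹ (λ k → M k j))) ⟩
    M i j - N⁻¹ * sum (λ k → M k j)
      ≡⟨ cong (λ s → M i j - N⁻¹ * s) (trans (sum-cong-≗ (λ k → M-sym k j)) (M-rows j)) ⟩
    M i j - N⁻¹ * 0ℚ
      ≡⟨ solve 2 (λ x r → x :- r :* con 0ℚ := x) refl (M i j) N⁻¹ ⟩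
    M i j ∎

  X-isMoorePenrose : IsMoorePenrose L X
  X-isMoorePenrose = record
    { AA†A≋A   = λ i j → trans (sum-cong-≗ (λ k → cong (_* L k j) (LX i k))) (centering L L-sym L-rows i j)
    ; A†AA†≋A† = λ i j → trans (sum-cong-≗ (λ k → cong (_* X k j) (XL i k))) (centering X X-sym X-rows i j)
    ; AA†-sym  = λ i j → trans (LX j i) (trans (cong (_- N⁻¹) (δ-sym j i)) (sym (LX i j)))
    ; A†A-sym  = λ i j → trans (XL j i) (trans (cong (_- N⁻¹) (δ-sym j i)) (sym (XL i j)))
    }

  -- The coordinates of `δ i` - `δ j` sum to zero, so the corrections `a` and `b` cancel.
  X-form : ∀ i j → sum (λ k → sum (λ l → (δ i k - δ j k) * X k l * (δ i l - δ j l)))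
                 ≡ Y i i + Y j j - (Y i j + Y i j)
  X-form i j = begin
    sum (λ k → sum (λ l → (δ i k - δ j k) * X k l * (δ i l - δ j l)))
      ≡⟨ sum-cong-≗ (λ k → begin
           sum (λ l → (δ i k - δ j k) * X k l * (δ i l - δ j l))
             ≡⟨ sum-cong-≗ (λ l → solve 3 (λ d x e → d :* x :* e := d :* (e :* x))
                  refl (δ i k - δ j k) (X k l) (δ i l - δ j l)) ⟩
           sum (λ l → (δ i k - δ j k) * ((δ i l - δ j l) * X k l))
             ≡⟨ *-distribˡ-sum (δ i k - δ j k) (λ l → (δ i l - δ j l) * X k l) ⟨
           (δ i k - δ j k) * sum (λ l → (δ i l - δ j l) * X k l)
             ≡⟨ cong ((δ i k - δ j k) *_) (sum-δ-δ i j (X k)) ⟩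
           (δ i k - δ j k) * (X k i - X k j) ∎) ⟩
    sum (λ k → (δ i k - δ j k) * (X k i - X k j))
      ≡⟨ sum-δ-δ i j (λ k → X k i - X k j) ⟩
    (X i i - X i j) - (X j i - X j j)
      ≡⟨ cong (λ y → (X i i - X i j) - ((y - a j - a i + b) - X j j)) (Y-sym j i) ⟩
    (X i i - X i j) - ((Y i j - a j - a i + b) - X j j)
      ≡⟨ solve 6 (λ yii yij yjj p q r →
           ((yii :- p :- p :+ r) :- (yij :- p :- q :+ r)) :- ((yij :- q :- p :+ r) :- (yjj :- q :- q :+ r))
           := yii :+ yjj :- (yij :+ yij)) refl (Y i i) (Y i j) (Y j j) (a i) (a j) b ⟩
    Y i i + Y j j - (Y i j + Y i j) ∎

ind-× : ∀ {p q} {P : Set p} {Q : Set q} (P? : Dec P) (Q? : Dec Q) →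
        ind (P? ×-dec Q?) ≡ ind P? * ind Q?
ind-× (yes _) Q? = sym (ℚ.*-identityˡ (ind Q?))
ind-× (no _)  Q? = sym (ℚ.*-zeroˡ (ind Q?))

-- The sum counts witnesses, and uniqueness bounds the count by one.
ind-any : ∀ {N p} {P : Fin N → Set p} (P? : ∀ i → Dec (P i)) →
          (∀ {i j} → P i → P j → i ≡ j) → ind (any? P?) ≡ sum (λ i → ind (P? i))
ind-any {P = P} P? unique with any? P?
... | yes (i , p) = trans (sym (sum-δ₁ i)) (sum-cong-≗ λ j → ind-cong (i ≟ j) (P? j) (λ i≡j → subst P i≡j p) (unique p))
... | no ¬p = sym (sum-zero (λ i → ind-no (P? i) (λ p → ¬p (i , p))))

ind-⊎ : ∀ {p q} {P : Set p} {Q : Set q} (P? : Dec P) (Q? : Dec Q) → ¬ (P × Q) →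
        ind (P? ⊎-dec Q?) ≡ ind P? + ind Q?
ind-⊎ (yes p) Q? ¬pq = trans (sym (ℚ.+-identityʳ 1ℚ)) (cong (λ s → 1ℚ + s) (sym (ind-no Q? (λ q → ¬pq (p , q)))))
ind-⊎ (no _)  Q? ¬pq = sym (ℚ.+-identityˡ (ind Q?))

sum-δ² : ∀ {M N} (i : Fin M) (k : Fin N) (F : Fin M → Fin N → ℚ) →
         sum (λ j → sum (λ l → δ i j * δ k l * F j l)) ≡ F i k
sum-δ² i k F = begin
  sum (λ j → sum (λ l → δ i j * δ k l * F j l))
    ≡⟨ sum-cong-≗ (λ j → trans (sum-cong-≗ (λ l → ℚ.*-assoc (δ i j) (δ k l) (F j l))) (sym (*-distribˡ-sum (δ i j) (λ l → δ k l * F j l)))) ⟩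
  sum (λ j → δ i j * sum (λ l → δ k l * F j l))
    ≡⟨ sum-δ i (λ j → sum (λ l → δ k l * F j l)) ⟩
  sum (λ l → δ k l * F i l)
    ≡⟨ sum-δ k (F i) ⟩
  F i k ∎

-- Second differences of the minimum and the Green's function of a segment.

ν : ℕ → ℚ
ν k = ι (+ k)

ν-suc : ∀ k → ν (suc k) ≡ 1ℚ + ν k
ν-suc k = trans (ι-+ (+ 1) (+ k)) (cong (_+ ν k) ι-1)

twice : ℕ → ℕ
twice zero    = zero
twice (suc k) = suc (suc (twice k))

twice-injective : ∀ {a b} → twice a ≡ twice b → a ≡ b
twice-injective {zero}  {zero}  _  = refl
twice-injective {suc a} {suc b} eq = cong suc (twice-injective (ℕ.suc-injective (ℕ.suc-injective eq)))

twice≢1+twice : ∀ a b → twice a ≢ suc (twice b)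
twice≢1+twice (suc a) (suc b) eq = twice≢1+twice a b (ℕ.suc-injective (ℕ.suc-injective eq))

twice-mono : ∀ {a b} → a ≤ b → twice a ≤ twice b
twice-mono z≤n     = z≤n
twice-mono (s≤s p) = s≤s (s≤s (twice-mono p))

opaque
  unfolding ι

  ⊓-kink-base : ∀ p q → p ⊓ q ≡ 0 → ν (p ⊓ q) + ν (suc (suc p) ⊓ q) + ind (q ℕ.≟ suc p) ≡ ν (suc p ⊓ q) + ν (suc p ⊓ q)
  ⊓-kink-base zero    zero          _ = refl
  ⊓-kink-base zero    (suc zero)    _ = refl
  ⊓-kink-base zero    (suc (suc q)) _ = refl
  ⊓-kink-base (suc p) zero          _ = refl

-- In its first argument the minimum has slope 1 up to `q` and slope 0 beyond, so its second
-- difference is -1 at `q` and 0 elsewhere. Lowering both arguments together reduces this to the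
-- case where one of them is zero.
⊓-kink : ∀ p q → ν (p ⊓ q) + ν (suc (suc p) ⊓ q) + ind (q ℕ.≟ suc p) ≡ ν (suc p ⊓ q) + ν (suc p ⊓ q)
⊓-kink zero    q             = ⊓-kink-base zero q refl
⊓-kink (suc p) zero          = ⊓-kink-base (suc p) zero refl
⊓-kink (suc p) (suc q)       = begin
  ν (suc (p ⊓ q)) + ν (suc (suc (suc p) ⊓ q)) + ind (q ℕ.≟ suc p)
    ≡⟨ cong (_+ ind (q ℕ.≟ suc p)) (cong₂ _+_ (ν-suc (p ⊓ q)) (ν-suc (suc (suc p) ⊓ q))) ⟩
  (1ℚ + ν (p ⊓ q)) + (1ℚ + ν (suc (suc p) ⊓ q)) + ind (q ℕ.≟ suc p)
    ≡⟨ solve 3 (λ a b d → (con 1ℚ :+ a) :+ (con 1ℚ :+ b) :+ d := con 1ℚ :+ con 1ℚ :+ (a :+ b :+ d)) refl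
         (ν (p ⊓ q)) (ν (suc (suc p) ⊓ q)) (ind (q ℕ.≟ suc p)) ⟩
  1ℚ + 1ℚ + (ν (p ⊓ q) + ν (suc (suc p) ⊓ q) + ind (q ℕ.≟ suc p))
    ≡⟨ cong (λ s → 1ℚ + 1ℚ + s) (⊓-kink p q) ⟩
  1ℚ + 1ℚ + (ν (suc p ⊓ q) + ν (suc p ⊓ q))
    ≡⟨ solve 1 (λ a → con 1ℚ :+ con 1ℚ :+ (a :+ a) := (con 1ℚ :+ a) :+ (con 1ℚ :+ a)) refl (ν (suc p ⊓ q)) ⟩
  (1ℚ + ν (suc p ⊓ q)) + (1ℚ + ν (suc p ⊓ q))
    ≡⟨ cong₂ _+_ (ν-suc (suc p ⊓ q)) (ν-suc (suc p ⊓ q)) ⟨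
  ν (suc (suc p ⊓ q)) + ν (suc (suc p ⊓ q)) ∎

⊓-top : ∀ M q → q ≤ suc M → ν (suc M ⊓ q) ≡ ν (M ⊓ q) + ind (q ℕ.≟ suc M)
⊓-top M q q≤1+M with ℕ.m≤n⇒m<n∨m≡n q≤1+M
... | inj₁ q<1+M = begin
  ν (suc M ⊓ q)
    ≡⟨ cong ν (trans (ℕ.m≥n⇒m⊓n≡n q≤1+M) (sym (ℕ.m≥n⇒m⊓n≡n (ℕ.s≤s⁻¹ q<1+M)))) ⟩
  ν (M ⊓ q)                              ≡⟨ ℚ.+-identityʳ (ν (M ⊓ q)) ⟨
  ν (M ⊓ q) + 0ℚ                         ≡⟨ cong (λ s → ν (M ⊓ q) + s) (ind-no (q ℕ.≟ suc M) (ℕ.<⇒≢ q<1+M)) ⟨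
  ν (M ⊓ q) + ind (q ℕ.≟ suc M)          ∎
... | inj₂ refl = begin
  ν (suc M ⊓ suc M)                      ≡⟨ cong ν (ℕ.⊓-idem (suc M)) ⟩
  ν (suc M)                              ≡⟨ trans (ν-suc M) (ℚ.+-comm 1ℚ (ν M)) ⟩
  ν M + 1ℚ
    ≡⟨ cong₂ _+_ (cong ν (ℕ.m≤n⇒m⊓n≡m (ℕ.n≤1+n M))) (ind-yes (suc M ℕ.≟ suc M) refl) ⟨
  ν (M ⊓ suc M) + ind (suc M ℕ.≟ suc M)  ∎

-- The Green's function of a segment of length 1/κ with grounded ends.
module Green (κ : ℚ) where

  opaque

    G : ℕ → ℕ → ℚ
    G p q = ν (p ⊓ q) - ν p * ν q * κ

    G-sym : ∀ p q → G p q ≡ G q p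
    G-sym p q = cong₂ (λ s t → ν s - t * κ) (ℕ.⊓-comm p q) (ℚ.*-comm (ν p) (ν q))

    G-zero : ∀ q → G 0 q ≡ 0ℚ
    G-zero q = trans (cong (λ z → z - z * ν q * κ) ι-0) $ solve 2 (λ x k → con 0ℚ :- con 0ℚ :* x :* k := con 0ℚ) refl (ν q) κ

    -- The product term is linear in the first argument, so only the minimum contributes to the
    -- second difference.
    G-kink : ∀ p q → G p q + G (suc (suc p)) q ≡ G (suc p) q + G (suc p) q - ind (q ℕ.≟ suc p)
    G-kink p q = begin
      (a - ν p * ν q * κ) + (b - ν (suc (suc p)) * ν q * κ)
        ≡⟨ cong₂ (λ s t → (a - ν p * ν q * κ) + (s - t * ν q * κ))
             (solve 3 (λ a b d → b := (a :+ b :+ d) :- a :- d) refl a b d)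
             (trans (ν-suc (suc p)) (cong (λ s → 1ℚ + s) (ν-suc p))) ⟩
      (a - ν p * ν q * κ) + ((a + b + d - a - d) - (1ℚ + (1ℚ + ν p)) * ν q * κ)
        ≡⟨ cong (λ s → (a - ν p * ν q * κ) + ((s - a - d) - (1ℚ + (1ℚ + ν p)) * ν q * κ)) (⊓-kink p q) ⟩
      (a - ν p * ν q * κ) + ((c + c - a - d) - (1ℚ + (1ℚ + ν p)) * ν q * κ)
        ≡⟨ solve 6 (λ a c d p q k → (a :- p :* q :* k) :+ ((c :+ c :- a :- d) :- (con 1ℚ :+ (con 1ℚ :+ p)) :* q :* k)
             := (c :- (con 1ℚ :+ p) :* q :* k) :+ (c :- (con 1ℚ :+ p) :* q :* k) :- d) refl a c d (ν p) (ν q) κ ⟩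
      (c - (1ℚ + ν p) * ν q * κ) + (c - (1ℚ + ν p) * ν q * κ) - d
        ≡⟨ cong (λ s → (c - s * ν q * κ) + (c - s * ν q * κ) - d) (ν-suc p) ⟨
      (c - ν (suc p) * ν q * κ) + (c - ν (suc p) * ν q * κ) - d ∎
      where
      a b c d : ℚ
      a = ν (p ⊓ q)
      b = ν (suc (suc p) ⊓ q)
      c = ν (suc p ⊓ q)
      d = ind (q ℕ.≟ suc p)

    -- Positions 0 and `suc M` will be the same grounded vertex, so its current is the sum of the
    -- slopes at the two ends. The slopes -1 + qκ at 0 and -qκ at `suc M` add up to -1, and a source
    -- placed at `suc M` itself restores the unit.
    G-ends : ∀ M q → 1 ≤ q → q ≤ suc M → (G (suc M) q - G M q) + (G 0 q - G 1 q) ≡ ind (q ℕ.≟ suc M) - 1ℚ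
    G-ends M q@(suc q′) _ q≤1+M = begin
      ((ν (suc M ⊓ q) - ν (suc M) * ν q * κ) - (a - ν M * ν q * κ)) + (G 0 q - (ν 1 - ν 1 * ν q * κ))
        ≡⟨ cong₂ (λ s (t , o) → s - (a - ν M * ν q * κ) + (t - (o - o * ν q * κ)))
             (cong₂ (λ s t → s - t * ν q * κ) (⊓-top M q q≤1+M) (ν-suc M)) (cong₂ _,_ (G-zero q) ι-1) ⟩
      ((a + d) - (1ℚ + ν M) * ν q * κ) - (a - ν M * ν q * κ) + (0ℚ - (1ℚ - 1ℚ * ν q * κ))
        ≡⟨ solve 5 (λ a d m q k → ((a :+ d) :- (con 1ℚ :+ m) :* q :* k) :- (a :- m :* q :* k) :+ (con 0ℚ :- (con 1ℚ :- con 1ℚ :* q :* k))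
             := d :- con 1ℚ) refl a d (ν M) (ν q) κ ⟩
      d - 1ℚ ∎
      where
      a d : ℚ
      a = ν (M ⊓ q)
      d = ind (q ℕ.≟ suc M)

    G-last : ∀ M → ν M * κ ≡ 1ℚ → ∀ q → q ≤ M → G M q ≡ 0ℚ
    G-last M Mκ≡1 q q≤M = begin
      ν (M ⊓ q) - ν M * ν q * κ
        ≡⟨ cong₂ _-_ (cong ν (ℕ.m≥n⇒m⊓n≡n q≤M)) (solve 3 (λ m q k → m :* q :* k := q :* (m :* k))
             refl (ν M) (ν q) κ) ⟩
      ν q - ν q * (ν M * κ)      ≡⟨ cong (λ s → ν q - ν q * s) Mκ≡1 ⟩
      ν q - ν q * 1ℚ             ≡⟨ solve 1 (λ q → q :- q :* con 1ℚ := con 0ℚ) refl (ν q) ⟩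
      0ℚ ∎

    -- For κ = 1/M the value is D(M - D)/M, the resistance of D and M - D unit edges in parallel.
    G-distance : ∀ p D → G p p + G (p ℕ.+ D) (p ℕ.+ D) - (G p (p ℕ.+ D) + G p (p ℕ.+ D)) ≡ ν D - ν D * ν D * κ
    G-distance p D = begin
      (ν (p ⊓ p) - a * a * κ) + (ν ((p ℕ.+ D) ⊓ (p ℕ.+ D)) - b * b * κ) - ((ν (p ⊓ (p ℕ.+ D)) - a * b * κ) + (ν (p ⊓ (p ℕ.+ D)) - a * b * κ))
        ≡⟨ cong₂ (λ s t → s - (t + t))
             (cong₂ (λ s t → (ν s - a * a * κ) + (ν t - b * b * κ)) (ℕ.⊓-idem p) (ℕ.⊓-idem (p ℕ.+ D)))
             (cong (λ s → ν s - a * b * κ) (ℕ.m≤n⇒m⊓n≡m (ℕ.m≤m+n p D))) ⟩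
      (a - a * a * κ) + (b - b * b * κ) - ((a - a * b * κ) + (a - a * b * κ))
        ≡⟨ cong (λ b → (a - a * a * κ) + (b - b * b * κ) - ((a - a * b * κ) + (a - a * b * κ))) (ι-+ (+ p) (+ D)) ⟩
      (a - a * a * κ) + ((a + ν D) - (a + ν D) * (a + ν D) * κ) - ((a - a * (a + ν D) * κ) + (a - a * (a + ν D) * κ))
        ≡⟨ solve 3 (λ a d k → (a :- a :* a :* k) :+ ((a :+ d) :- (a :+ d) :* (a :+ d) :* k) :- ((a :- a :* (a :+ d) :* k) :+ (a :- a :* (a :+ d) :* k))
             := d :- d :* d :* k) refl a (ν D) κ ⟩
      ν D - ν D * ν D * κ ∎
      where
      a b : ℚ
      a = ν p
      b = ν (p ℕ.+ D)

    -- Going the other way round a circle of length M = 1/κ.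
    distance-complement : ∀ M → ν M * κ ≡ 1ℚ → ∀ D E → D ℕ.+ E ≡ M → ν D - ν D * ν D * κ ≡ ν E - ν E * ν E * κ
    distance-complement M Mκ≡1 D E D+E≡M = begin
      d - d * d * κ
        ≡⟨ cong (_- d * d * κ) (ℚ.*-identityʳ d) ⟨
      d * 1ℚ - d * d * κ
        ≡⟨ cong (λ s → d * s - d * d * κ) 1≡ ⟩
      d * ((d + e) * κ) - d * d * κ
        ≡⟨ solve 3 (λ d e k → d :* ((d :+ e) :* k) :- d :* d :* k := e :* ((d :+ e) :* k) :- e :* e :* k) refl d e κ ⟩
      e * ((d + e) * κ) - e * e * κ
        ≡⟨ cong (λ s → e * s - e * e * κ) 1≡ ⟨
      e * 1ℚ - e * e * κ
        ≡⟨ cong (_- e * e * κ) (ℚ.*-identityʳ e) ⟩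
      e - e * e * κ ∎
      where
      d e : ℚ
      d = ν D
      e = ν E
      1≡ : 1ℚ ≡ (d + e) * κ
      1≡ = trans (sym Mκ≡1) (cong (_* κ) (trans (cong ν (sym D+E≡M)) (ι-+ (+ D) (+ E))))

    -- Here `D` is the length of the walk from `p` to `q` in increasing direction. In the second
    -- alternative this walk passes the cut 0 = M, so `G-distance` applies to the complementary arc.
    G-distance-around : ∀ M → ν M * κ ≡ 1ℚ → ∀ p q D → p ℕ.+ D ≡ q ⊎ (q ≤ p × p ℕ.+ D ≡ q ℕ.+ M) →
                        G p p + G q q - (G p q + G p q) ≡ ν D - ν D * ν D * κ
    G-distance-around M Mκ≡1 p _ D (inj₁ refl) = G-distance p D
    G-distance-around M Mκ≡1 p q D (inj₂ (q≤p , p+D≡q+M)) = begin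
      G p p + G q q - (G p q + G p q)
        ≡⟨ cong₂ (λ s t → s - (t + t)) (ℚ.+-comm (G p p) (G q q)) (G-sym p q) ⟩
      G q q + G p p - (G q p + G q p)
        ≡⟨ cong (λ p → G q q + G p p - (G q p + G q p)) q+E≡p ⟨
      G q q + G (q ℕ.+ E) (q ℕ.+ E) - (G q (q ℕ.+ E) + G q (q ℕ.+ E))
        ≡⟨ G-distance q E ⟩
      ν E - ν E * ν E * κ
        ≡⟨ distance-complement M Mκ≡1 E D E+D≡M ⟩
      ν D - ν D * ν D * κ ∎
      where
      E : ℕ
      E = p ℕ.∸ q
      q+E≡p : q ℕ.+ E ≡ p
      q+E≡p = ℕ.m+[n∸m]≡n q≤p
      E+D≡M : E ℕ.+ D ≡ M
      E+D≡M = ℕ.+-cancelˡ-≡ q (E ℕ.+ D) M (trans (sym (ℕ.+-assoc q E D)) (trans (cong (ℕ._+ D) q+E≡p) p+D≡q+M))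

-- Combinatorics of the gluing.

prev-injective : ∀ {n} {i j : Fin n} → prev i ≡ prev j → i ≡ j
prev-injective {i = zero}  {zero}  _  = refl
prev-injective {i = zero}  {suc j} eq = contradiction eq Fin.fromℕ≢inject₁
prev-injective {i = suc i} {zero}  eq = contradiction (sym eq) Fin.fromℕ≢inject₁
prev-injective {i = suc i} {suc j} eq = cong suc (Fin.inject₁-injective eq)

prev-surjective : ∀ {n} (j : Fin n) → ∃[ i ] prev i ≡ j
prev-surjective {suc _} j with view j
... | ‵fromℕ     = zero , refl
... | ‵inject₁ i = suc i , refl

prev≢id : ∀ {n} (i : Fin (suc (suc n))) → prev i ≢ i
prev≢id (suc i) eq = ℕ.1+n≢n (trans (sym (cong toℕ eq)) (Fin.toℕ-inject₁ i))

-- With only two petals `prev` would be an involution, so the index type has at least three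
-- elements.
prev²≢id : ∀ {n} (i : Fin (suc (suc (suc n)))) → prev (prev i) ≢ i
prev²≢id (suc (suc i)) eq = ℕ.m≢1+n+m (toℕ i) {1} (trans (sym (trans (Fin.toℕ-inject₁ (inject₁ i)) (Fin.toℕ-inject₁ i))) (cong toℕ eq))

module Glue (m n : ℕ) (x y : Fin (suc m)) (x≢y : x ≢ y) where
  open Flower (complete (suc m)) n x y x≢y

  glue-y : ∀ i → glue i y ≡ combine (prev i) (punchOut (≢-sym x≢y))
  glue-y i with y ≟ y
  ... | yes _  = refl
  ... | no y≢y = contradiction refl y≢y

  glue-≢y : ∀ i {k} (y≢k : y ≢ k) → glue i k ≡ combine i (punchOut y≢k)
  glue-≢y i {k} y≢k with y ≟ k
  ... | yes y≡k = contradiction y≡k y≢k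
  ... | no _    = cong (combine i) (Fin.punchOut-cong y refl)

  glue-link : ∀ i → glue i y ≡ glue (prev i) x
  glue-link i = trans (glue-y i) (sym (glue-≢y (prev i) (≢-sym x≢y)))

  -- Since `combine` and `punchOut` are injective, names can collide only through the clause of
  -- `glue` that sends a copy of `y` to the preceding petal.
  glue-split : ∀ {i j k l} → glue i k ≡ glue j l →
               (i ≡ j × k ≡ l) ⊎ (k ≡ y × l ≡ x × prev i ≡ j) ⊎ (k ≡ x × l ≡ y × i ≡ prev j)
  glue-split {i} {j} {k} {l} eq with y ≟ k | y ≟ l
  ... | yes refl | yes refl = inj₁ (prev-injective (proj₁ (Fin.combine-injective _ _ _ _ eq)) , refl)
  ... | yes refl | no  y≢l  = let (i≡j , r) = Fin.combine-injective _ _ _ _ eq in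
    inj₂ (inj₁ (refl , sym (Fin.punchOut-injective (≢-sym x≢y) y≢l r) , i≡j))
  ... | no  y≢k  | yes refl = let (i≡j , r) = Fin.combine-injective _ _ _ _ eq in
    inj₂ (inj₂ (Fin.punchOut-injective y≢k (≢-sym x≢y) r , refl , i≡j))
  ... | no  y≢k  | no  y≢l  = let (i≡j , r) = Fin.combine-injective _ _ _ _ eq in
    inj₁ (i≡j , Fin.punchOut-injective y≢k y≢l r)

  -- With `copy`, the canonical name of a vertex: an associated vertex is attributed to the petal in
  -- which it is the copy of `x`.
  petal : Vertex → Fin n
  petal u = proj₁ (remQuot m u)

  copy : Vertex → Fin (suc m)
  copy u = punchIn y (proj₂ (remQuot {n} m u))

  copy≢y : ∀ u → copy u ≢ y
  copy≢y u = Fin.punchInᵢ≢i y _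

  glue-petal-copy : ∀ u → glue (petal u) (copy u) ≡ u
  glue-petal-copy u = trans (glue-≢y (petal u) (≢-sym (copy≢y u)))
    (trans (cong (combine (petal u)) (Fin.punchOut-punchIn y)) (Fin.combine-remQuot {n} m u))

  petal-copy-glue : ∀ {i k} → k ≢ y → petal (glue i k) ≡ i × copy (glue i k) ≡ k
  petal-copy-glue {i} {k} k≢y with glue-split (glue-petal-copy (glue i k))
  ... | inj₁ same                 = same
  ... | inj₂ (inj₁ (c≡y , _))     = contradiction c≡y (copy≢y (glue i k))
  ... | inj₂ (inj₂ (_ , k≡y , _)) = contradiction k≡y k≢y

  data Kind : Fin (suc m) → Set where
    isx   : Kind x
    isy   : Kind y
    inner : ∀ {k} → k ≢ x → k ≢ y → Kind k

  kind : ∀ k → Kind k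
  kind k with k ≟ x | k ≟ y
  ... | yes refl | _        = isx
  ... | no _     | yes refl = isy
  ... | no k≢x   | no k≢y   = inner k≢x k≢y

-- Doubling and the counting of petals.

twice-+ : ∀ a b → twice (a ℕ.+ b) ≡ twice a ℕ.+ twice b
twice-+ zero    b = refl
twice-+ (suc a) b = cong (λ r → suc (suc r)) (twice-+ a b)

twice≡+ : ∀ a → twice a ≡ a ℕ.+ a
twice≡+ zero    = refl
twice≡+ (suc a) = cong suc (trans (cong suc (twice≡+ a)) (sym (ℕ.+-suc a a)))

-- The number `e` of steps is one less than the number of petals. The summand `n` inside the
-- remainder keeps the truncated subtraction exact; the remainder removes it again precisely when
-- `s` does not lie beyond `t`.
petalCount-steps : ∀ {n} (s t : Fin n) → ∃[ e ] petalCount s t ≡ suc e ×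
                   (e ℕ.+ toℕ s ≡ toℕ t ⊎ (toℕ t ℕ.< toℕ s × e ℕ.+ toℕ s ≡ toℕ t ℕ.+ n))
petalCount-steps {n@(suc _)} s t with toℕ s ℕ.≤? toℕ t
... | yes s≤t = toℕ t ℕ.∸ toℕ s , cong suc count , inj₁ (ℕ.m∸n+n≡m s≤t)
  where
  count : (toℕ t ℕ.+ n ℕ.∸ toℕ s) % n ≡ toℕ t ℕ.∸ toℕ s
  count = begin
    (toℕ t ℕ.+ n ℕ.∸ toℕ s) % n    ≡⟨ cong (_% n) (ℕ.+-∸-comm n s≤t) ⟩
    (toℕ t ℕ.∸ toℕ s ℕ.+ n) % n    ≡⟨ [m+n]%n≡m%n (toℕ t ℕ.∸ toℕ s) n ⟩
    (toℕ t ℕ.∸ toℕ s) % n          ≡⟨ m<n⇒m%n≡m (ℕ.≤-<-trans (ℕ.m∸n≤m (toℕ t) (toℕ s)) (Fin.toℕ<n t)) ⟩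
    toℕ t ℕ.∸ toℕ s                ∎
... | no s≰t = toℕ t ℕ.+ n ℕ.∸ toℕ s , cong suc (m<n⇒m%n≡m e<n) , inj₂ (ℕ.≰⇒> s≰t , ℕ.m∸n+n≡m s≤t+n)
  where
  s≤t+n : toℕ s ≤ toℕ t ℕ.+ n
  s≤t+n = ℕ.≤-trans (ℕ.<⇒≤ (Fin.toℕ<n s)) (ℕ.m≤n+m n (toℕ t))
  e<n : toℕ t ℕ.+ n ℕ.∸ toℕ s ℕ.< n
  e<n = ℕ.+-cancelʳ-< (toℕ s) (toℕ t ℕ.+ n ℕ.∸ toℕ s) n (subst₂ ℕ._<_ (sym (ℕ.m∸n+n≡m s≤t+n)) (ℕ.+-comm (toℕ s) n) (ℕ.+-monoˡ-< n (ℕ.≰⇒> s≰t)))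

-- Evaluation of fractions, and Laplacians of arbitrary graphs.

-- Inverses are unique, so products such as `μ * κ` can replace the reciprocal of a composite
-- denominator.
/-as-*-inverse : ∀ z N .{{_ : NonZero N}} {r} → ν N * r ≡ 1ℚ → z / N ≡ ι z * r
/-as-*-inverse z N {r} Nr≡1 = begin
  z / N                              ≡⟨ /-as-* z N ⟩
  ι z * (+ 1 / N)                    ≡⟨ cong (ι z *_) (ℚ.*-identityʳ (+ 1 / N)) ⟨
  ι z * ((+ 1 / N) * 1ℚ)             ≡⟨ cong (λ s → ι z * ((+ 1 / N) * s)) Nr≡1 ⟨
  ι z * ((+ 1 / N) * (ν N * r))
    ≡⟨ cong (ι z *_) (solve 3 (λ a b c → a :* (b :* c) := (b :* a) :* c) refl (+ 1 / N) (ν N) r) ⟩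
  ι z * ((ν N * (+ 1 / N)) * r)      ≡⟨ cong (λ s → ι z * (s * r)) (n*1/n≡1 N) ⟩
  ι z * (1ℚ * r)                     ≡⟨ cong (ι z *_) (ℚ.*-identityˡ r) ⟩
  ι z * r                            ∎

ι-- : ∀ a b → ι (a ℤ.- b) ≡ ι a - ι b
ι-- a b = trans (ι-+ a (ℤ.- b)) (cong (λ s → ι a + s) (ι-neg b))

2ℚ : ℚ
2ℚ = 1ℚ + 1ℚ

ι-2 : ι (+ 2) ≡ 2ℚ
ι-2 = trans (ν-suc 1) (cong (λ s → 1ℚ + s) ι-1)

ι-square : ∀ a → ι (a ℤ.^ 2) ≡ ι a * ι a
ι-square a = trans (cong (λ b → ι (a ℤ.* b)) (ℤ.*-identityʳ a)) (ι-* a a)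

ν-* : ∀ a b → ν (a ℕ.* b) ≡ ν a * ν b
ν-* a b = trans (cong ι (ℤ.pos-* a b)) (ι-* (+ a) (+ b))

ν-twice : ∀ a → ν (twice a) ≡ ν a + ν a
ν-twice a = trans (cong ν (twice≡+ a)) (ι-+ (+ a) (+ a))

-- Spreading the degree over the neighbours turns the diagonal term into potential differences, one
-- for each edge at `u`.
laplacian-apply : ∀ {N} (H : Graph N) (f : Fin N → ℚ) u →
                  sum (λ w → laplacian H u w * f w) ≡ sum (λ w → adjacency H u w * (f u - f w))
laplacian-apply H f u = begin
  sum (λ w → (D * δ u w - a w) * f w)
    ≡⟨ sum-cong-≗ (λ w → solve 4 (λ D d a f → (D :* d :- a) :* f := d :* (D :* f) :- a :* f) refl D (δ u w) (a w) (f w)) ⟩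
  sum (λ w → δ u w * (D * f w) - a w * f w)
    ≡⟨ ∑-distrib-- (λ w → δ u w * (D * f w)) (λ w → a w * f w) ⟩
  sum (λ w → δ u w * (D * f w)) - sum (λ w → a w * f w)
    ≡⟨ cong (_- sum (λ w → a w * f w)) (trans (sum-δ u (λ w → D * f w)) (*-distribʳ-sum (f u) a)) ⟩
  sum (λ w → a w * f u) - sum (λ w → a w * f w)
    ≡⟨ ∑-distrib-- (λ w → a w * f u) (λ w → a w * f w) ⟨
  sum (λ w → a w * f u - a w * f w)
    ≡⟨ sum-cong-≗ (λ w → solve 3 (λ a f g → a :* f :- a :* g := a :* (f :- g)) refl (a w) (f u) (f w)) ⟩
  sum (λ w → a w * (f u - f w)) ∎
  where
  D : ℚ
  D = degree H u
  a : _ → ℚ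
  a = adjacency H u

laplacian-sym : ∀ {N} (H : Graph N) i j → laplacian H i j ≡ laplacian H j i
laplacian-sym H i j = cong₂ _-_ degree-δ
  (ind-cong (Graph.Adj? H i j) (Graph.Adj? H j i) (Graph.symm H) (Graph.symm H))
  where
  degree-δ : degree H i * δ i j ≡ degree H j * δ j i
  degree-δ with i ≟ j
  ... | yes refl = cong (degree H i *_) (sym (ind-yes (i ≟ i) refl))
  ... | no i≢j   = trans (ℚ.*-zeroʳ (degree H i))
    (sym (trans (cong (degree H j *_) (ind-no (j ≟ i) (i≢j ∘ sym))) (ℚ.*-zeroʳ (degree H j))))

laplacian-rows : ∀ {N} (H : Graph N) i → sum (laplacian H i) ≡ 0ℚ
laplacian-rows H i = begin
  sum (λ j → degree H i * δ i j - adjacency H i j)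
    ≡⟨ ∑-distrib-- (λ j → degree H i * δ i j) (adjacency H i) ⟩
  sum (λ j → degree H i * δ i j) - degree H i
    ≡⟨ cong (_- degree H i) (trans (sym (*-distribˡ-sum (degree H i) (δ i))) (trans (cong (degree H i *_) (sum-δ₁ i)) (ℚ.*-identityʳ (degree H i)))) ⟩
  degree H i - degree H i
    ≡⟨ ℚ.+-inverseʳ (degree H i) ⟩
  0ℚ ∎

sum-*-exchange : ∀ {M N} (F : Fin M → Fin N → ℚ) (g : Fin N → ℚ) →
                 sum (λ w → sum (λ i → F i w) * g w) ≡ sum (λ i → sum (λ w → F i w * g w))
sum-*-exchange F g = trans (sum-cong-≗ (λ w → *-distribʳ-sum (g w) (λ i → F i w))) (∑-comm (λ w i → F i w * g w))

-- The petals have `suc m` vertices, so `m` counts those other than `y`. The reciprocals `μ` and `κ`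
-- are known only through their equations, which makes the identities below polynomial.
module FlowerGreen (m n′ : ℕ) (x y : Fin (suc m)) (x≢y : x ≢ y)
  (μ κ : ℚ) (mμ≡1 : ν (suc m) * μ ≡ 1ℚ) (2nκ≡1 : ν (twice (suc (suc (suc n′)))) * κ ≡ 1ℚ) where

  n : ℕ
  n = suc (suc (suc n′))

  open Flower (complete (suc m)) n x y x≢y
  open Glue m n x y x≢y

  open Green κ

  -- Positions on the cycle, potentials, and currents within a petal.

  level : Fin (suc m) → ℕ
  level k with kind k
  ... | isy       = 0
  ... | isx       = 2
  ... | inner _ _ = 1

  -- m times the resistance of the leg by which the copy of k hangs off the cycle.
  h : Fin (suc m) → ℚ
  h k = ind (¬? (k ≟ x) ×-dec ¬? (k ≟ y))

  h-y : h y ≡ 0ℚ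
  h-y = ind-no (¬? (y ≟ x) ×-dec ¬? (y ≟ y)) (λ (_ , y≢y) → y≢y refl)

  h-x : h x ≡ 0ℚ
  h-x = ind-no (¬? (x ≟ x) ×-dec ¬? (x ≟ y)) (λ (x≢x , _) → x≢x refl)

  h-inner : ∀ {k} → k ≢ x → k ≢ y → h k ≡ 1ℚ
  h-inner {k} k≢x k≢y = ind-yes (¬? (k ≟ x) ×-dec ¬? (k ≟ y)) (k≢x , k≢y)

  -- The position on the cycle of the point to which the copy of k in petal i is attached.
  -- The grounded vertex is xₙ₋₁ = y₀ (indexing from 0), with the two positions 2n and 0.
  place : Fin n → Fin (suc m) → ℕ
  place i k = level k ℕ.+ twice (toℕ i)

  level-y : level y ≡ 0
  level-y with kind y
  ... | isy         = refl
  ... | isx         = contradiction refl x≢y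
  ... | inner _ y≢y = contradiction refl y≢y

  level-x : level x ≡ 2
  level-x with kind x
  ... | isy         = contradiction refl x≢y
  ... | isx         = refl
  ... | inner x≢x _ = contradiction refl x≢x

  level-inner : ∀ {k} → k ≢ x → k ≢ y → level k ≡ 1
  level-inner {k} k≢x k≢y with kind k
  ... | isy       = contradiction refl k≢y
  ... | isx       = contradiction refl k≢x
  ... | inner _ _ = refl

  place-y : ∀ i → place i y ≡ twice (toℕ i)
  place-y i = cong (ℕ._+ twice (toℕ i)) level-y

  place-x : ∀ i → place i x ≡ suc (suc (twice (toℕ i)))
  place-x i = cong (ℕ._+ twice (toℕ i)) level-x

  place-inner : ∀ i {k} → k ≢ x → k ≢ y → place i k ≡ suc (twice (toℕ i))
  place-inner i k≢x k≢y = cong (ℕ._+ twice (toℕ i)) (level-inner k≢x k≢y)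

  pos : Vertex → ℕ
  pos u = place (petal u) (copy u)

  place≤next : ∀ i k → place i k ≤ twice (suc (toℕ i))
  place≤next i k with kind k
  ... | isx       = ℕ.≤-refl
  ... | isy       = ℕ.m≤n+m (twice (toℕ i)) 2
  ... | inner _ _ = ℕ.m≤n+m (suc (twice (toℕ i))) 1

  place≤ : ∀ i k → place i k ≤ twice n
  place≤ i k = ℕ.≤-trans (place≤next i k) (twice-mono (Fin.toℕ<n i))

  1≤pos : ∀ u → 1 ≤ pos u
  1≤pos u = bound (copy≢y u)
    where
    bound : ∀ {i k} → k ≢ y → 1 ≤ place i k
    bound {k = k} k≢y with kind k
    ... | isx       = s≤s z≤n
    ... | isy       = contradiction refl k≢y
    ... | inner _ _ = s≤s z≤n

  -- Column `v` is the potential when a unit current enters at `v` and leaves at the grounded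
  -- vertex. The leg of `v` raises the potential of `v` alone, so `h` occurs only on the diagonal;
  -- `μ` is the resistance of one edge.
  Y : Matrix (n ℕ.* m) (n ℕ.* m)
  Y u v = μ * (h (copy u) * δ u v + G (pos u) (pos v))

  h-δ-sym : ∀ u v → h (copy u) * δ u v ≡ h (copy v) * δ v u
  h-δ-sym u v = case u ≟ v of λ
    { (yes refl) → refl
    ; (no u≢v)   → trans (h-δ-≢ u≢v) (sym (h-δ-≢ (u≢v ∘ sym))) }
    where
    h-δ-≢ : ∀ {u v} → u ≢ v → h (copy u) * δ u v ≡ 0ℚ
    h-δ-≢ {u} {v} u≢v = trans (cong (λ s → h (copy u) * s) (ind-no (u ≟ v) u≢v)) (ℚ.*-zeroʳ (h (copy u)))

  Y-sym : ∀ u v → Y u v ≡ Y v u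
  Y-sym u v = cong (μ *_) (cong₂ _+_ (h-δ-sym u v) (G-sym (pos u) (pos v)))

  -- The two names of an associated vertex have equal positions except at the grounded vertex, where
  -- they are 2n and 0. There `G` vanishes at both, at 2n by means of the bound on `q`.
  place-prev : ∀ {q} → q ≤ twice n → ∀ i → G (place (prev i) x) q ≡ G (place i y) q
  place-prev {q} q≤2n i = trans (cong (λ p → G p q) (place-x (prev i)))
    (trans (lemma i) (cong (λ p → G p q) (sym (place-y i))))
    where
    lemma : ∀ i → G (suc (suc (twice (toℕ (prev i))))) q ≡ G (twice (toℕ i)) q
    lemma zero    = trans (cong (λ t → G (suc (suc (twice t))) q) (Fin.toℕ-fromℕ (suc (suc n′))))
      (trans (G-last (twice n) 2nκ≡1 q q≤2n) (sym (G-zero q)))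
    lemma (suc i) = cong (λ t → G (suc (suc (twice t))) q) (Fin.toℕ-inject₁ i)

  G-pos-glue : ∀ i k {q} → q ≤ twice n → G (pos (glue i k)) q ≡ G (place i k) q
  G-pos-glue i k {q} q≤2n with glue-split (glue-petal-copy (glue i k))
  ... | inj₁ (p≡i , c≡k) = cong₂ (λ i′ k′ → G (place i′ k′) q) p≡i c≡k
  ... | inj₂ (inj₁ (c≡y , _)) = contradiction c≡y (copy≢y (glue i k))
  ... | inj₂ (inj₂ (c≡x , refl , p≡)) = trans (cong₂ (λ i k → G (place i k) q) p≡ c≡x) (place-prev q≤2n i)

  h-copy-glue : ∀ i k → h (copy (glue i k)) ≡ h k
  h-copy-glue i k with glue-split (glue-petal-copy (glue i k))
  ... | inj₁ (_ , c≡k) = cong h c≡k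
  ... | inj₂ (inj₁ (c≡y , _)) = contradiction c≡y (copy≢y (glue i k))
  ... | inj₂ (inj₂ (c≡x , refl , _)) = trans (cong h c≡x) (trans h-x (sym h-y))

  Y-glue : ∀ i k v → Y (glue i k) v ≡ μ * (h k * δ (glue i k) v + G (place i k) (pos v))
  Y-glue i k v = cong (μ *_) (cong₂ _+_
    (cong (_* δ (glue i k) v) (h-copy-glue i k)) (G-pos-glue i k (place≤ (petal v) (copy v))))

  module _ (v : Vertex) where

    q : ℕ
    q = pos v

    -- The current that leaves the copy of k through petal i when the potential is Y · v.
    flux : Fin n → Fin (suc m) → ℚ
    flux i k = (h k * δ (glue i k) v + G (place i k) q) - G (suc (twice (toℕ i))) q

    rise fall : Fin n → ℚ
    rise i = G (twice (toℕ i)) q - G (suc (twice (toℕ i))) q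
    fall i = G (suc (suc (twice (toℕ i)))) q - G (suc (twice (toℕ i))) q

    flux-y : ∀ i → flux i y ≡ rise i
    flux-y i = trans (cong₂ (λ s p → (s * δ (glue i y) v + G p q) - G (suc (twice (toℕ i))) q) h-y (place-y i))
      (solve 3 (λ d a b → (con 0ℚ :* d :+ a) :- b := a :- b) refl
        (δ (glue i y) v) (G (twice (toℕ i)) q) (G (suc (twice (toℕ i))) q))

    flux-x : ∀ i → flux i x ≡ fall i
    flux-x i = trans (cong₂ (λ s p → (s * δ (glue i x) v + G p q) - G (suc (twice (toℕ i))) q) h-x (place-x i))
      (solve 3 (λ d a b → (con 0ℚ :* d :+ a) :- b := a :- b) refl
        (δ (glue i x) v) (G (suc (suc (twice (toℕ i)))) q) (G (suc (twice (toℕ i))) q))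

    flux-inner : ∀ i {k} → k ≢ x → k ≢ y → flux i k ≡ δ (glue i k) v
    flux-inner i {k} k≢x k≢y = trans
      (cong₂ (λ s p → (s * δ (glue i k) v + G p q) - G (suc (twice (toℕ i))) q) (h-inner k≢x k≢y) (place-inner i k≢x k≢y))
      (solve 2 (λ d a → (con 1ℚ :* d :+ a) :- a := d) refl (δ (glue i k) v) (G (suc (twice (toℕ i))) q))

  -- Odd positions are the centres. A copy of `x` sits at an even position, and there `h` is zero;
  -- an inner copy sits at the centre of its own petal.
  pos-odd : ∀ {l} → l ≢ y → ∀ i j → ind (place j l ℕ.≟ suc (twice (toℕ i))) ≡ h l * δ j i
  pos-odd {l} l≢y i j = lemma (kind l)
    where
    p : ℕ
    p = suc (twice (toℕ i))
    lemma : Kind l → ind (place j l ℕ.≟ p) ≡ h l * δ j i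
    lemma isx = trans (ind-no (place j x ℕ.≟ p) λ eq → twice≢1+twice _ _ (trans (sym (place-x j)) eq))
                      (sym (trans (cong (_* δ j i) h-x) (ℚ.*-zeroˡ (δ j i))))
    lemma isy = contradiction refl l≢y
    lemma (inner l≢x l≢y) = begin
      ind (place j l ℕ.≟ p)  ≡⟨ ind-cong (place j l ℕ.≟ p) (j ≟ i)
                                   (λ eq → Fin.toℕ-injective (twice-injective (ℕ.suc-injective (trans (sym (place-inner j l≢x l≢y)) eq))))
                                   (λ { refl → place-inner j l≢x l≢y }) ⟩
      δ j i                  ≡⟨ ℚ.*-identityˡ (δ j i) ⟨
      1ℚ * δ j i             ≡⟨ cong (_* δ j i) (h-inner l≢x l≢y) ⟨
      h l * δ j i            ∎

  δ-glue-inner : ∀ {l} → l ≢ x → l ≢ y → ∀ i j k → δ (glue i k) (glue j l) ≡ δ j i * δ l k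
  δ-glue-inner {l} l≢x l≢y i j k = trans
    (ind-cong (glue i k ≟ glue j l) ((j ≟ i) ×-dec (l ≟ k)) split (λ { (refl , refl) → refl }))
    (ind-× (j ≟ i) (l ≟ k))
    where
    split : glue i k ≡ glue j l → j ≡ i × l ≡ k
    split eq with glue-split eq
    ... | inj₁ (i≡j , k≡l)          = sym i≡j , sym k≡l
    ... | inj₂ (inj₁ (_ , l≡x , _)) = contradiction l≡x l≢x
    ... | inj₂ (inj₂ (_ , l≡y , _)) = contradiction l≡y l≢y

  -- At the centre of the petal, the kink of G cancels the current of the leg holding v.
  sum-flux : ∀ v i → sum (flux v i) ≡ 0ℚ
  sum-flux v i = begin
    sum (flux v i)
      -- Current flows only at the two associated vertices of the petal and in the leg of `v`; the
      -- factor `h l` switches the last term off when `v` is associated.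
      ≡⟨ sum-cong-≗ (λ k → expand k (kind k)) ⟩
    sum (λ k → δ y k * rise v i + δ x k * fall v i + δ l k * (h l * δ j i))
      ≡⟨ trans (∑-distrib-+ (λ k → δ y k * rise v i + δ x k * fall v i) (λ k → δ l k * (h l * δ j i)))
               (cong (_+ sum (λ k → δ l k * (h l * δ j i))) (∑-distrib-+ (λ k → δ y k * rise v i) (λ k → δ x k * fall v i))) ⟩
    sum (λ k → δ y k * rise v i) + sum (λ k → δ x k * fall v i) + sum (λ k → δ l k * (h l * δ j i))
      ≡⟨ cong₂ _+_ (cong₂ _+_ (sum-δ y (λ _ → rise v i)) (sum-δ x (λ _ → fall v i))) (sum-δ l (λ _ → h l * δ j i)) ⟩
    rise v i + fall v i + h l * δ j i
      ≡⟨ cong (λ s → rise v i + fall v i + s) (pos-odd (copy≢y v) i j) ⟨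
    (G p q′ - G (suc p) q′) + (G (suc (suc p)) q′ - G (suc p) q′) + ind (q′ ℕ.≟ suc p)
      ≡⟨ solve 4 (λ a b c d → (a :- b) :+ (c :- b) :+ d := (a :+ c) :- (b :+ b :- d))
           refl (G p q′) (G (suc p) q′) (G (suc (suc p)) q′) (ind (q′ ℕ.≟ suc p)) ⟩
    (G p q′ + G (suc (suc p)) q′) - (G (suc p) q′ + G (suc p) q′ - ind (q′ ℕ.≟ suc p))
      ≡⟨ cong (λ s → s - (G (suc p) q′ + G (suc p) q′ - ind (q′ ℕ.≟ suc p))) (G-kink p q′) ⟩
    (G (suc p) q′ + G (suc p) q′ - ind (q′ ℕ.≟ suc p)) - (G (suc p) q′ + G (suc p) q′ - ind (q′ ℕ.≟ suc p))
      ≡⟨ ℚ.+-inverseʳ (G (suc p) q′ + G (suc p) q′ - ind (q′ ℕ.≟ suc p)) ⟩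
    0ℚ ∎
    where
    p q′ : ℕ
    p = twice (toℕ i)
    q′ = pos v
    j : Fin n
    j = petal v
    l : Fin (suc m)
    l = copy v

    combination : ∀ {a b c d} (r f s : ℚ) → a ≡ b → c ≡ d → b * r + d * f + s ≡ a * r + c * f + s
    combination r f s refl refl = refl

    off-hubs : ∀ {k} → k ≢ x → k ≢ y → Dec (l ≡ k) → δ (glue i k) v ≡ δ l k * (h l * δ j i)
    off-hubs {k} k≢x k≢y (yes refl) = begin
      δ (glue i k) v                     ≡⟨ cong (δ (glue i k)) (glue-petal-copy v) ⟨
      δ (glue i k) (glue j k)            ≡⟨ δ-glue-inner k≢x k≢y i j k ⟩
      δ j i * δ k k                      ≡⟨ ℚ.*-comm (δ j i) (δ k k) ⟩
      δ k k * δ j i                      ≡⟨ cong (δ k k *_) (ℚ.*-identityˡ (δ j i)) ⟨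
      δ k k * (1ℚ * δ j i)               ≡⟨ cong (λ s → δ k k * (s * δ j i)) (h-inner k≢x k≢y) ⟨
      δ k k * (h k * δ j i)              ∎
    off-hubs {k} k≢x k≢y (no l≢k) = begin
      δ (glue i k) v
        ≡⟨ ind-no (glue i k ≟ v) (λ gik≡v → l≢k (trans (cong copy (sym gik≡v)) (proj₂ (petal-copy-glue k≢y)))) ⟩
      0ℚ                       ≡⟨ ℚ.*-zeroˡ (h l * δ j i) ⟨
      0ℚ * (h l * δ j i)       ≡⟨ cong (_* (h l * δ j i)) (ind-no (l ≟ k) l≢k) ⟨
      δ l k * (h l * δ j i)    ∎

    δ-x-h : Dec (l ≡ x) → δ l x * (h l * δ j i) ≡ 0ℚ
    δ-x-h (yes l≡x) = trans (cong (λ s → δ l x * (s * δ j i)) (trans (cong h l≡x) h-x))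
      (solve 2 (λ a b → a :* (con 0ℚ :* b) := con 0ℚ) refl (δ l x) (δ j i))
    δ-x-h (no l≢x)  = trans (cong (_* (h l * δ j i)) (ind-no (l ≟ x) l≢x)) (ℚ.*-zeroˡ (h l * δ j i))

    expand : ∀ k → Kind k → flux v i k ≡ δ y k * rise v i + δ x k * fall v i + δ l k * (h l * δ j i)
    expand _ isx = begin
      flux v i x
        ≡⟨ flux-x v i ⟩
      fall v i
        ≡⟨ solve 2 (λ r f → f := con 0ℚ :* r :+ con 1ℚ :* f :+ con 0ℚ) refl (rise v i) (fall v i) ⟩
      0ℚ * rise v i + 1ℚ * fall v i + 0ℚ
        ≡⟨ combination (rise v i) (fall v i) 0ℚ (ind-no (y ≟ x) (≢-sym x≢y)) (ind-yes (x ≟ x) refl) ⟩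
      δ y x * rise v i + δ x x * fall v i + 0ℚ
        ≡⟨ cong (λ s → δ y x * rise v i + δ x x * fall v i + s) (δ-x-h (l ≟ x)) ⟨
      δ y x * rise v i + δ x x * fall v i + δ l x * (h l * δ j i) ∎
    expand _ isy = begin
      flux v i y
        ≡⟨ flux-y v i ⟩
      rise v i
        ≡⟨ solve 3 (λ r f s → r := con 1ℚ :* r :+ con 0ℚ :* f :+ con 0ℚ :* s)
             refl (rise v i) (fall v i) (h l * δ j i) ⟩
      1ℚ * rise v i + 0ℚ * fall v i + 0ℚ * (h l * δ j i)
        ≡⟨ combination (rise v i) (fall v i) (0ℚ * (h l * δ j i)) (ind-yes (y ≟ y) refl) (ind-no (x ≟ y) x≢y) ⟩
      δ y y * rise v i + δ x y * fall v i + 0ℚ * (h l * δ j i)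
        ≡⟨ cong (λ s → δ y y * rise v i + δ x y * fall v i + s * (h l * δ j i)) (ind-no (l ≟ y) (copy≢y v)) ⟨
      δ y y * rise v i + δ x y * fall v i + δ l y * (h l * δ j i) ∎
    expand k (inner k≢x k≢y) = begin
      flux v i k
        ≡⟨ flux-inner v i k≢x k≢y ⟩
      δ (glue i k) v
        ≡⟨ off-hubs k≢x k≢y (l ≟ k) ⟩
      δ l k * (h l * δ j i)
        ≡⟨ solve 3 (λ r f s → s := con 0ℚ :* r :+ con 0ℚ :* f :+ s)
             refl (rise v i) (fall v i) (δ l k * (h l * δ j i)) ⟩
      0ℚ * rise v i + 0ℚ * fall v i + δ l k * (h l * δ j i)
        ≡⟨ combination (rise v i) (fall v i) (δ l k * (h l * δ j i)) (ind-no (y ≟ k) (≢-sym k≢y)) (ind-no (x ≟ k) (≢-sym k≢x)) ⟩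
      δ y k * rise v i + δ x k * fall v i + δ l k * (h l * δ j i) ∎

  -- The exchange of star and clique: measured from the centre, the potentials of the petal sum to
  -- zero by `sum-flux`, so only the `suc m` equal terms of the copy `k` remain, and their factor
  -- `suc m` cancels `μ`.
  Y-drop : ∀ v i k → sum (λ l → Y (glue i k) v - Y (glue i l) v) ≡ flux v i k
  Y-drop v i k = begin
    sum (λ l → Y (glue i k) v - Y (glue i l) v)
      ≡⟨ sum-cong-≗ (λ l → trans (cong₂ _-_ (Y-glue i k v) (Y-glue i l v))
           (solve 4 (λ r s t c → r :* s :- r :* t := r :* (s :- c) :- r :* (t :- c)) refl μ
              (h k * δ (glue i k) v + G (place i k) (pos v)) (h l * δ (glue i l) v + G (place i l) (pos v)) (G (suc (twice (toℕ i))) (pos v)))) ⟩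
    sum (λ l → μ * flux v i k - μ * flux v i l)
      ≡⟨ ∑-distrib-- {suc m} (λ _ → μ * flux v i k) (λ l → μ * flux v i l) ⟩
    sum {suc m} (λ _ → μ * flux v i k) - sum (λ l → μ * flux v i l)
      ≡⟨ cong₂ _-_ (sum-const (suc m) (μ * flux v i k)) (trans (sym (*-distribˡ-sum μ (flux v i))) (cong (μ *_) (sum-flux v i))) ⟩
    ν (suc m) * (μ * flux v i k) - μ * 0ℚ
      ≡⟨ solve 3 (λ a r f → a :* (r :* f) :- r :* con 0ℚ := (a :* r) :* f) refl (ν (suc m)) μ (flux v i k) ⟩
    (ν (suc m) * μ) * flux v i k
      ≡⟨ trans (cong (_* flux v i k) mμ≡1) (ℚ.*-identityˡ (flux v i k)) ⟩
    flux v i k ∎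

  -- The Laplacian as a sum over the petals.

  glue-injective : ∀ {i k l} → glue i k ≡ glue i l → k ≡ l
  glue-injective {i} eq with glue-split eq
  ... | inj₁ (_ , k≡l)           = k≡l
  ... | inj₂ (inj₁ (_ , _ , p))  = contradiction p (prev≢id i)
  ... | inj₂ (inj₂ (_ , _ , p))  = contradiction (sym p) (prev≢id i)

  -- Distinct petals containing both ends would each precede the other, against `prev²≢id`.
  edge-petal-unique : ∀ {i j k k′ l l′} → k ≢ l → glue i k ≡ glue j k′ → glue i l ≡ glue j l′ → i ≡ j
  edge-petal-unique {i} k≢l eq₁ eq₂ with glue-split eq₁ | glue-split eq₂
  ... | inj₁ (i≡j , _)              | _                           = i≡j
  ... | _                           | inj₁ (i≡j , _)              = i≡j
  ... | inj₂ (inj₁ (k≡y , _))       | inj₂ (inj₁ (l≡y , _))       = contradiction (trans k≡y (sym l≡y)) k≢l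
  ... | inj₂ (inj₂ (k≡x , _))       | inj₂ (inj₂ (l≡x , _))       = contradiction (trans k≡x (sym l≡x)) k≢l
  ... | inj₂ (inj₁ (_ , _ , refl))  | inj₂ (inj₂ (_ , _ , p))     = contradiction (sym p) (prev²≢id i)
  ... | inj₂ (inj₂ (_ , _ , p))     | inj₂ (inj₁ (_ , _ , refl))  = contradiction (sym p) (prev²≢id i)

  edge : Vertex → Vertex → Fin n → Fin (suc m) → Fin (suc m) → ℚ
  edge u w i k l = ind (¬? (k ≟ l)) * (δ (glue i k) u * δ (glue i l) w)

  -- An edge determines its petal and the copies of its two ends, so each existential quantifier
  -- becomes a sum.
  adjacency-expand : ∀ u w → adjacency flower u w ≡ sum (λ i → sum (λ k → sum (λ l → edge u w i k l)))
  adjacency-expand u w = begin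
    ind (Graph.Adj? flower u w)
      ≡⟨ ind-cong (Graph.Adj? flower u w) (any? E₁?) proj₂ (λ e → loopless e , e) ⟩
    ind (any? E₁?)
      ≡⟨ ind-any E₁? (λ { (_ , _ , k≢l , refl , refl) (_ , _ , _ , p , r) → edge-petal-unique k≢l (sym p) (sym r) }) ⟩
    sum (λ i → ind (E₁? i))
      ≡⟨ sum-cong-≗ (λ i → ind-any (E₂? i) (λ { (_ , _ , refl , _) (_ , _ , p , _) → sym (glue-injective p) })) ⟩
    sum (λ i → sum (λ k → ind (E₂? i k)))
      ≡⟨ sum-cong-≗ (λ i → sum-cong-≗ (λ k → ind-any (E₃? i k) (λ { (_ , _ , refl) (_ , _ , p) → sym (glue-injective p) }))) ⟩
    sum (λ i → sum (λ k → sum (λ l → ind (E₃? i k l))))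
      ≡⟨ sum-cong-≗ (λ i → sum-cong-≗ (λ k → sum-cong-≗ (λ l → trans (ind-× (¬? (k ≟ l)) (glue i k ≟ u ×-dec glue i l ≟ w))
           (cong (ind (¬? (k ≟ l)) *_) (ind-× (glue i k ≟ u) (glue i l ≟ w)))))) ⟩
    sum (λ i → sum (λ k → sum (λ l → edge u w i k l))) ∎
    where
    E₃? : ∀ i k l → Dec (k ≢ l × glue i k ≡ u × glue i l ≡ w)
    E₃? i k l = ¬? (k ≟ l) ×-dec (glue i k ≟ u ×-dec glue i l ≟ w)
    E₂? : ∀ i k → Dec (∃[ l ] k ≢ l × glue i k ≡ u × glue i l ≡ w)
    E₂? i k = any? (E₃? i k)
    E₁? : ∀ i → Dec (∃[ k ] ∃[ l ] k ≢ l × glue i k ≡ u × glue i l ≡ w)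
    E₁? i = any? (E₂? i)
    loopless : (∃[ i ] ∃[ k ] ∃[ l ] k ≢ l × glue i k ≡ u × glue i l ≡ w) → u ≢ w
    loopless (_ , _ , _ , k≢l , refl , refl) eq = k≢l (glue-injective eq)

  -- Each petal contributes the Laplacian of its clique, and `u` collects one term for each of its
  -- names. Terms with equal copies may be included because their potential difference is zero.
  flower-laplacian : ∀ (f : Vertex → ℚ) u → sum (λ w → laplacian flower u w * f w) ≡
    sum (λ i → sum (λ k → δ (glue i k) u * sum (λ l → f (glue i k) - f (glue i l))))
  flower-laplacian f u = begin
    sum (λ w → laplacian flower u w * f w)
      ≡⟨ laplacian-apply flower f u ⟩
    sum (λ w → adjacency flower u w * D w)
      ≡⟨ sum-cong-≗ (λ w → cong (_* D w) (adjacency-expand u w)) ⟩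
    sum (λ w → sum (λ i → sum (λ k → sum (λ l → edge u w i k l))) * D w)
      ≡⟨ sum-*-exchange (λ i w → sum (λ k → sum (λ l → edge u w i k l))) D ⟩
    sum (λ i → sum (λ w → sum (λ k → sum (λ l → edge u w i k l)) * D w))
      ≡⟨ sum-cong-≗ (λ i → trans (sum-*-exchange (λ k w → sum (λ l → edge u w i k l)) D)
           (sum-cong-≗ (λ k → trans (sum-*-exchange (λ l w → edge u w i k l) D)
             (trans (sum-cong-≗ (λ l → collapse i k l))
             (sym (*-distribˡ-sum (δ (glue i k) u) (λ l → f (glue i k) - f (glue i l)))))))) ⟩
    sum (λ i → sum (λ k → δ (glue i k) u * sum (λ l → f (glue i k) - f (glue i l)))) ∎
    where
    D : Vertex → ℚ
    D w = f u - f w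

    same : ∀ i k l → Dec (k ≡ l) → ind (¬? (k ≟ l)) * (f (glue i k) - f (glue i l)) ≡ f (glue i k) - f (glue i l)
    same i k _ (yes refl) = trans (cong (_* (f (glue i k) - f (glue i k))) (ind-no (¬? (k ≟ k)) (λ k≢k → k≢k refl)))
      (solve 1 (λ a → con 0ℚ :* (a :- a) := a :- a) refl (f (glue i k)))
    same i k l (no k≢l)   = trans (cong (_* (f (glue i k) - f (glue i l))) (ind-yes (¬? (k ≟ l)) k≢l)) (ℚ.*-identityˡ (f (glue i k) - f (glue i l)))

    at : ∀ i k l → Dec (glue i k ≡ u) → δ (glue i k) u * (ind (¬? (k ≟ l)) * D (glue i l)) ≡ δ (glue i k) u * (f (glue i k) - f (glue i l))
    at i k l (yes refl) = cong (δ (glue i k) (glue i k) *_) (same i k l (k ≟ l))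
    at i k l (no ≢u)    = trans (cong (_* (ind (¬? (k ≟ l)) * D (glue i l))) (ind-no (glue i k ≟ u) ≢u))
      (trans (solve 2 (λ a b → con 0ℚ :* a := con 0ℚ :* b) refl (ind (¬? (k ≟ l)) * D (glue i l)) (f (glue i k) - f (glue i l)))
             (cong (_* (f (glue i k) - f (glue i l))) (sym (ind-no (glue i k ≟ u) ≢u))))

    collapse : ∀ i k l → sum (λ w → edge u w i k l * D w) ≡ δ (glue i k) u * (f (glue i k) - f (glue i l))
    collapse i k l = begin
      sum (λ w → edge u w i k l * D w)
        ≡⟨ sum-cong-≗ (λ w → solve 4 (λ a b c d → a :* (b :* c) :* d := c :* (b :* (a :* d)))
             refl (ind (¬? (k ≟ l))) (δ (glue i k) u) (δ (glue i l) w) (D w)) ⟩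
      sum (λ w → δ (glue i l) w * (δ (glue i k) u * (ind (¬? (k ≟ l)) * D w)))
        ≡⟨ sum-δ (glue i l) (λ w → δ (glue i k) u * (ind (¬? (k ≟ l)) * D w)) ⟩
      δ (glue i k) u * (ind (¬? (k ≟ l)) * D (glue i l))
        ≡⟨ at i k l (glue i k ≟ u) ⟩
      δ (glue i k) u * (f (glue i k) - f (glue i l)) ∎

  -- Kirchhoff's law at the associated vertices, and the product of the Laplacian with `Y`.

  δ-glue-x : ∀ j v → δ (glue j x) v ≡ ind (pos v ℕ.≟ suc (suc (twice (toℕ j))))
  δ-glue-x j v = ind-cong (glue j x ≟ v) (pos v ℕ.≟ suc (suc (twice (toℕ j)))) to from
    where
    to : glue j x ≡ v → pos v ≡ suc (suc (twice (toℕ j)))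
    to refl = let (p≡j , c≡x) = petal-copy-glue x≢y in trans (cong₂ place p≡j c≡x) (place-x j)

    from′ : ∀ i {l} → l ≢ y → Kind l → place i l ≡ suc (suc (twice (toℕ j))) → glue j x ≡ glue i l
    from′ i l≢y isx eq = cong (λ i → glue i x)
      (Fin.toℕ-injective (twice-injective (ℕ.suc-injective (ℕ.suc-injective (trans (sym eq) (place-x i))))))
    from′ i l≢y isy eq = contradiction refl l≢y
    from′ i l≢y (inner l≢x _) eq =
      contradiction (ℕ.suc-injective (trans (sym (place-inner i l≢x l≢y)) eq)) (twice≢1+twice _ _)

    from : pos v ≡ suc (suc (twice (toℕ j))) → glue j x ≡ v
    from eq = trans (from′ (petal v) (copy≢y v) (kind (copy v)) eq) (glue-petal-copy v)

  -- The two summands are the two names of an associated vertex; through them the currents of two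
  -- neighbouring petals meet.
  δ-glue-link : ∀ i k j → δ (glue i k) (glue (prev j) x) ≡ δ (prev j) i * δ x k + δ j i * δ y k
  δ-glue-link i k j = begin
    δ (glue i k) (glue (prev j) x)
      ≡⟨ ind-cong (glue i k ≟ glue (prev j) x) (A? ⊎-dec B?) to from ⟩
    ind (A? ⊎-dec B?)
      ≡⟨ ind-⊎ A? B? (λ ((_ , x≡k) , (_ , y≡k)) → x≢y (trans x≡k (sym y≡k))) ⟩
    ind A? + ind B?
      ≡⟨ cong₂ _+_ (ind-× (prev j ≟ i) (x ≟ k)) (ind-× (j ≟ i) (y ≟ k)) ⟩
    δ (prev j) i * δ x k + δ j i * δ y k ∎
    where
    A? : Dec (prev j ≡ i × x ≡ k)
    A? = (prev j ≟ i) ×-dec (x ≟ k)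
    B? : Dec (j ≡ i × y ≡ k)
    B? = (j ≟ i) ×-dec (y ≟ k)
    to : glue i k ≡ glue (prev j) x → (prev j ≡ i × x ≡ k) ⊎ (j ≡ i × y ≡ k)
    to eq with glue-split eq
    ... | inj₁ (i≡ , k≡)              = inj₁ (sym i≡ , sym k≡)
    ... | inj₂ (inj₁ (k≡y , _ , p))   = inj₂ (sym (prev-injective p) , sym k≡y)
    ... | inj₂ (inj₂ (_ , x≡y , _))   = contradiction x≡y x≢y
    from : (prev j ≡ i × x ≡ k) ⊎ (j ≡ i × y ≡ k) → glue i k ≡ glue (prev j) x
    from (inj₁ (refl , refl)) = refl
    from (inj₂ (refl , refl)) = glue-link j

  root : Vertex
  root = glue zero y

  -- For a successor the vertex lies inside the segment and the current is the kink of `G`. For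
  -- `zero` it is the grounded vertex, where the two ends of the segment meet and the unit current
  -- leaves.
  net-flux : ∀ v j → fall v (prev j) + rise v j ≡ δ (glue (prev j) x) v - δ root (glue (prev j) x)
  net-flux v zero = begin
    (g (suc (suc (twice t))) - g (suc (twice t))) + (g 0 - g 1)
      ≡⟨ cong (λ t → (g (suc (suc (twice t))) - g (suc (twice t))) + (g 0 - g 1)) (Fin.toℕ-fromℕ (suc (suc n′))) ⟩
    (g (twice n) - g (suc (twice (suc (suc n′))))) + (g 0 - g 1)
      ≡⟨ G-ends (suc (twice (suc (suc n′)))) (pos v) (1≤pos v) (place≤ (petal v) (copy v)) ⟩
    ind (pos v ℕ.≟ twice n) - 1ℚ
      ≡⟨ cong (λ t → ind (pos v ℕ.≟ suc (suc (twice t))) - 1ℚ) (Fin.toℕ-fromℕ (suc (suc n′))) ⟨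
    ind (pos v ℕ.≟ suc (suc (twice t))) - 1ℚ
      ≡⟨ cong₂ _-_ (δ-glue-x (prev zero) v) (ind-yes (root ≟ glue (prev zero) x) (glue-link zero)) ⟨
    δ (glue (prev zero) x) v - δ root (glue (prev zero) x) ∎
    where
    t : ℕ
    t = toℕ (prev {n} zero)
    g : ℕ → ℚ
    g p = G p (pos v)
  net-flux v (suc i) = begin
    fall v (inject₁ i) + rise v (suc i)
      ≡⟨ cong (λ t → (g (suc (suc (twice t))) - g (suc (twice t))) + rise v (suc i)) (Fin.toℕ-inject₁ i) ⟩
    (g (suc p) - g p) + (g (suc p) - g (suc (suc p)))
      ≡⟨ solve 3 (λ a b c → (b :- a) :+ (b :- c) := (b :+ b) :- (a :+ c))
           refl (g p) (g (suc p)) (g (suc (suc p))) ⟩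
    (g (suc p) + g (suc p)) - (g p + g (suc (suc p)))
      ≡⟨ cong (λ s → (g (suc p) + g (suc p)) - s) (G-kink p (pos v)) ⟩
    (g (suc p) + g (suc p)) - (g (suc p) + g (suc p) - ind (pos v ℕ.≟ suc p))
      ≡⟨ solve 2 (λ b d → (b :+ b) :- (b :+ b :- d) := d :- con 0ℚ) refl (g (suc p)) (ind (pos v ℕ.≟ suc p)) ⟩
    ind (pos v ℕ.≟ suc p) - 0ℚ
      ≡⟨ cong (λ t → ind (pos v ℕ.≟ suc (suc (twice t))) - 0ℚ) (Fin.toℕ-inject₁ i) ⟨
    ind (pos v ℕ.≟ suc (suc (twice (toℕ (inject₁ i))))) - 0ℚ
      ≡⟨ cong₂ _-_ (δ-glue-x (inject₁ i) v) (ind-no (root ≟ glue (inject₁ i) x) root≢) ⟨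
    δ (glue (inject₁ i) x) v - δ root (glue (inject₁ i) x) ∎
    where
    p : ℕ
    p = suc (twice (toℕ i))
    g : ℕ → ℚ
    g p = G p (pos v)
    root≢ : root ≢ glue (inject₁ i) x
    root≢ eq with glue-split eq
    ... | inj₁ (_ , y≡x)            = x≢y (sym y≡x)
    ... | inj₂ (inj₁ (_ , _ , p))   = Fin.fromℕ≢inject₁ p
    ... | inj₂ (inj₂ (y≡x , _))     = x≢y (sym y≡x)

  laplacian-Y : ∀ u v → (laplacian flower · Y) u v ≡ δ u v - δ root u
  laplacian-Y u v = begin
    (laplacian flower · Y) u v
      ≡⟨ flower-laplacian (λ w → Y w v) u ⟩
    sum (λ i → sum (λ k → δ (glue i k) u * sum (λ l → Y (glue i k) v - Y (glue i l) v)))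
      ≡⟨ sum-cong-≗ (λ i → sum-cong-≗ (λ k → cong (δ (glue i k) u *_) (Y-drop v i k))) ⟩
    total u
      -- The canonical name of `u` allows a case distinction on its copy, with `y` excluded.
      ≡⟨ cong total (glue-petal-copy u) ⟨
    total (glue (petal u) (copy u))
      ≡⟨ at (petal u) (copy≢y u) (kind (copy u)) ⟩
    δ (glue (petal u) (copy u)) v - δ root (glue (petal u) (copy u))
      ≡⟨ cong (λ w → δ w v - δ root w) (glue-petal-copy u) ⟩
    δ u v - δ root u ∎
    where
    total : Vertex → ℚ
    total w = sum (λ i → sum (λ k → δ (glue i k) w * flux v i k))

    at-link : ∀ j → total (glue (prev j) x) ≡ δ (glue (prev j) x) v - δ root (glue (prev j) x)
    at-link j = begin
      sum (λ i → sum (λ k → δ (glue i k) (glue (prev j) x) * flux v i k))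
        ≡⟨ sum-cong-≗ (λ i → trans
             (sum-cong-≗ (λ k → trans (cong (_* flux v i k) (δ-glue-link i k j)) (ℚ.*-distribʳ-+ (flux v i k) (δ (prev j) i * δ x k) (δ j i * δ y k))))
             (∑-distrib-+ (λ k → δ (prev j) i * δ x k * flux v i k) (λ k → δ j i * δ y k * flux v i k))) ⟩
      sum (λ i → sum (λ k → δ (prev j) i * δ x k * flux v i k) + sum (λ k → δ j i * δ y k * flux v i k))
        ≡⟨ ∑-distrib-+ (λ i → sum (λ k → δ (prev j) i * δ x k * flux v i k)) (λ i → sum (λ k → δ j i * δ y k * flux v i k)) ⟩
      sum (λ i → sum (λ k → δ (prev j) i * δ x k * flux v i k)) + sum (λ i → sum (λ k → δ j i * δ y k * flux v i k))
        ≡⟨ cong₂ _+_ (sum-δ² (prev j) x (flux v)) (sum-δ² j y (flux v)) ⟩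
      flux v (prev j) x + flux v j y
        ≡⟨ cong₂ _+_ (flux-x v (prev j)) (flux-y v j) ⟩
      fall v (prev j) + rise v j
        ≡⟨ net-flux v j ⟩
      δ (glue (prev j) x) v - δ root (glue (prev j) x) ∎

    at : ∀ j {k} → k ≢ y → Kind k → total (glue j k) ≡ δ (glue j k) v - δ root (glue j k)
    at j k≢y isy = contradiction refl k≢y
    -- Every petal precedes some petal, which brings the vertex into the form required by `at-link`.
    at j k≢y isx = let (i , prev-i≡j) = prev-surjective j in
      subst (λ j → total (glue j x) ≡ δ (glue j x) v - δ root (glue j x)) prev-i≡j (at-link i)
    at j {l} l≢y (inner l≢x _) = begin
      sum (λ i → sum (λ k → δ (glue i k) (glue j l) * flux v i k))
        ≡⟨ sum-cong-≗ (λ i → sum-cong-≗ (λ k → cong (_* flux v i k) (δ-glue-inner l≢x l≢y i j k))) ⟩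
      sum (λ i → sum (λ k → δ j i * δ l k * flux v i k))
        ≡⟨ sum-δ² j l (flux v) ⟩
      flux v j l
        ≡⟨ flux-inner v j l≢x l≢y ⟩
      δ (glue j l) v
        ≡⟨ solve 1 (λ a → a := a :- con 0ℚ) refl (δ (glue j l) v) ⟩
      δ (glue j l) v - 0ℚ
        ≡⟨ cong (λ s → δ (glue j l) v - s) (ind-no (root ≟ glue j l) root≢) ⟨
      δ (glue j l) v - δ root (glue j l) ∎
      where
      root≢ : root ≢ glue j l
      root≢ eq with glue-split eq
      ... | inj₁ (_ , y≡l)            = l≢y (sym y≡l)
      ... | inj₂ (inj₁ (_ , l≡x , _)) = l≢x l≡x
      ... | inj₂ (inj₂ (y≡x , _))     = x≢y (sym y≡x)

  -- Resistance in terms of the length of an arc.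

  resistance : Vertex → Vertex → ℚ
  resistance u v = Y u u + Y v v - (Y u v + Y u v)

  resistance-sym : ∀ u v → resistance u v ≡ resistance v u
  resistance-sym u v = cong₂ (λ s t → s - (t + t)) (ℚ.+-comm (Y u u) (Y v v)) (Y-sym u v)

  resistance-refl : ∀ u → resistance u u ≡ 0ℚ
  resistance-refl u = ℚ.+-inverseʳ (Y u u + Y u u)

  isResistanceDistance : .{{_ : NonZero m}} → ∀ u v {r} → resistance u v ≡ r → IsResistanceDistance flower u v r
  isResistanceDistance u v refl = MP.X , MP.X-isMoorePenrose , sym (MP.X-form u v)
    where
    instance
      N≢0 : NonZero (n ℕ.* m)
      N≢0 = ℕ.m*n≢0 n m
    module MP = MoorePenrose (laplacian flower) Y (δ root) (laplacian-sym flower) (laplacian-rows flower) Y-sym laplacian-Y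

  -- The hypothesis on `h k` rules out an inner vertex paired with itself, whose leg would also
  -- enter the off-diagonal term. Otherwise the legs at both ends are in series with the cycle.
  arc-resistance : ∀ {s t k l} → k ≢ x → l ≢ y → h k * δ (glue s k) (glue t l) ≡ 0ℚ →
    ∀ D → place s k ℕ.+ D ≡ place t l ⊎ (place t l ≤ place s k × place s k ℕ.+ D ≡ place t l ℕ.+ twice n) →
    resistance (glue s k) (glue t l) ≡ μ * (h k + h l + (ν D - ν D * ν D * κ))
  arc-resistance {s} {t} {k} {l} k≢x l≢y hδ≡0 D around = begin
    Y u u + Y v v - (Y u v + Y u v)
      ≡⟨ cong₂ (λ a b → a - (b + b)) (cong₂ _+_ (Y-diagonal s k) (Y-diagonal t l)) Y-uv ⟩
    μ * (h k + G a a) + μ * (h l + G b b) - (μ * G a b + μ * G a b)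
      ≡⟨ solve 6 (λ r h i p q w → r :* (h :+ p) :+ r :* (i :+ q) :- (r :* w :+ r :* w) := r :* (h :+ i :+ (p :+ q :- (w :+ w))))
           refl μ (h k) (h l) (G a a) (G b b) (G a b) ⟩
    μ * (h k + h l + (G a a + G b b - (G a b + G a b)))
      ≡⟨ cong (λ r → μ * (h k + h l + r)) (G-distance-around (twice n) 2nκ≡1 a b D around) ⟩
    μ * (h k + h l + (ν D - ν D * ν D * κ)) ∎
    where
    u v : Vertex
    u = glue s k
    v = glue t l
    a b : ℕ
    a = place s k
    b = place t l

    G-pos-pos : ∀ i k j l → G (pos (glue i k)) (pos (glue j l)) ≡ G (place i k) (place j l)
    G-pos-pos i k j l = begin
      G (pos (glue i k)) (pos (glue j l))  ≡⟨ G-pos-glue i k (place≤ _ (copy (glue j l))) ⟩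
      G (place i k) (pos (glue j l))       ≡⟨ G-sym (place i k) (pos (glue j l)) ⟩
      G (pos (glue j l)) (place i k)       ≡⟨ G-pos-glue j l (place≤ i k) ⟩
      G (place j l) (place i k)            ≡⟨ G-sym (place j l) (place i k) ⟩
      G (place i k) (place j l)            ∎

    Y-diagonal : ∀ i k → Y (glue i k) (glue i k) ≡ μ * (h k + G (place i k) (place i k))
    Y-diagonal i k = cong (μ *_) (cong₂ _+_
      (trans (cong₂ _*_ (h-copy-glue i k) (ind-yes (glue i k ≟ glue i k) refl)) (ℚ.*-identityʳ (h k)))
      (G-pos-pos i k i k))

    Y-uv : Y u v ≡ μ * G a b
    Y-uv = cong (μ *_) (trans
      (cong₂ _+_ (trans (cong (_* δ u v) (h-copy-glue s k)) hδ≡0) (G-pos-pos s k t l)) (ℚ.+-identityˡ (G a b)))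

  associated-y : ∀ s → Associated (glue s y)
  associated-y s = prev s , sym (glue-link s)

  ¬associated-inner : ∀ {s k} → k ≢ x → k ≢ y → ¬ Associated (glue s k)
  ¬associated-inner k≢x k≢y (_ , eq) with glue-split eq
  ... | inj₁ (_ , x≡k)            = k≢x (sym x≡k)
  ... | inj₂ (inj₁ (x≡y , _))     = x≢y x≡y
  ... | inj₂ (inj₂ (_ , k≡y , _)) = k≢y k≡y

  -- Each step to the next petal advances the position by 2, and the levels correct for where the
  -- arc starts and ends. An arc that wraps round gains 2n.
  around : ∀ s t k l e D → D ℕ.+ level k ≡ level l ℕ.+ twice e →
    e ℕ.+ toℕ s ≡ toℕ t ⊎ (toℕ t ℕ.< toℕ s × e ℕ.+ toℕ s ≡ toℕ t ℕ.+ n) →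
    place s k ℕ.+ D ≡ place t l ⊎ (place t l ≤ place s k × place s k ℕ.+ D ≡ place t l ℕ.+ twice n)
  around s t k l e D eq = ⊎.map
    (λ e+s≡t → trans shift (cong (λ r → level l ℕ.+ twice r) e+s≡t))
    (λ (t<s , e+s≡t+n) →
      ℕ.≤-trans (place≤next t l) (ℕ.≤-trans (twice-mono t<s) (ℕ.m≤n+m (twice (toℕ s)) (level k))) ,
      trans shift (trans (cong (λ r → level l ℕ.+ twice r) e+s≡t+n)
        (trans (cong (level l ℕ.+_) (twice-+ (toℕ t) n)) (sym (ℕ.+-assoc (level l) (twice (toℕ t)) (twice n))))))
    where
    shift : place s k ℕ.+ D ≡ level l ℕ.+ twice (e ℕ.+ toℕ s)
    shift = begin
      level k ℕ.+ twice (toℕ s) ℕ.+ D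
        ≡⟨ ℕSolver.+-*-Solver.solve 3 (λ a b c → a ℕ:+ b ℕ:+ c ℕ:= (c ℕ:+ a) ℕ:+ b)
             refl (level k) (twice (toℕ s)) D ⟩
      (D ℕ.+ level k) ℕ.+ twice (toℕ s)      ≡⟨ cong (ℕ._+ twice (toℕ s)) eq ⟩
      level l ℕ.+ twice e ℕ.+ twice (toℕ s)  ≡⟨ ℕ.+-assoc (level l) (twice e) (twice (toℕ s)) ⟩
      level l ℕ.+ (twice e ℕ.+ twice (toℕ s)) ≡⟨ cong (level l ℕ.+_) (twice-+ e (toℕ s)) ⟨
      level l ℕ.+ twice (e ℕ.+ toℕ s)        ∎
      where open ℕSolver.+-*-Solver using () renaming (_:+_ to infixl 6 _ℕ:+_; _:=_ to infix 4 _ℕ:=_)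

  -- The three closed formulas.

  mn≢0 : NonZero (suc m ℕ.* n)
  mn≢0 = ℕ.m*n≢0 (suc m) n

  2mn≢0 : NonZero (2 ℕ.* suc m ℕ.* n)
  2mn≢0 = ℕ.m*n≢0 (2 ℕ.* suc m) n {{ℕ.m*n≢0 2 (suc m)}}

  hub-hub hub-inner inner-inner : ℕ → ℚ
  hub-hub d     = ((+ 2 ℤ.* + d ℤ.* (+ n ℤ.- + d)) / (suc m ℕ.* n)) {{mn≢0}}
  hub-inner d   = (+ 2 ℤ.* + d) / suc m - (((+ 2 ℤ.* + d ℤ.- + 1) ℤ.^ 2) / (2 ℕ.* suc m ℕ.* n)) {{2mn≢0}}
  inner-inner d = (+ 2 ℤ.* + d) / suc m - ((+ 2 ℤ.* (+ d ℤ.- + 1) ℤ.^ 2) / (suc m ℕ.* n)) {{mn≢0}}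

  n2κ≡1 : ν n * (κ + κ) ≡ 1ℚ
  n2κ≡1 = begin
    ν n * (κ + κ)        ≡⟨ solve 2 (λ a k → a :* (k :+ k) := (a :+ a) :* k) refl (ν n) κ ⟩
    (ν n + ν n) * κ      ≡⟨ cong (_* κ) (ν-twice n) ⟨
    ν (twice n) * κ      ≡⟨ 2nκ≡1 ⟩
    1ℚ                   ∎

  mn-inverse : ν (suc m ℕ.* n) * (μ * (κ + κ)) ≡ 1ℚ
  mn-inverse = begin
    ν (suc m ℕ.* n) * (μ * (κ + κ))      ≡⟨ cong (_* (μ * (κ + κ))) (ν-* (suc m) n) ⟩
    (ν (suc m) * ν n) * (μ * (κ + κ))
      ≡⟨ solve 4 (λ a b c d → (a :* b) :* (c :* d) := (a :* c) :* (b :* d)) refl (ν (suc m)) (ν n) μ (κ + κ) ⟩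
    (ν (suc m) * μ) * (ν n * (κ + κ))    ≡⟨ cong₂ _*_ mμ≡1 n2κ≡1 ⟩
    1ℚ * 1ℚ                              ≡⟨ ℚ.*-identityˡ 1ℚ ⟩
    1ℚ                                   ∎

  2mn-inverse : ν (2 ℕ.* suc m ℕ.* n) * (μ * κ) ≡ 1ℚ
  2mn-inverse = begin
    ν (2 ℕ.* suc m ℕ.* n) * (μ * κ)
      ≡⟨ cong (_* (μ * κ)) (trans (cong ν (ℕ.*-assoc 2 (suc m) n)) (trans (ν-* 2 (suc m ℕ.* n)) (cong (_* ν (suc m ℕ.* n)) ι-2))) ⟩
    (2ℚ * ν (suc m ℕ.* n)) * (μ * κ)
      ≡⟨ solve 3 (λ a r k → ((con 1ℚ :+ con 1ℚ) :* a) :* (r :* k) := a :* (r :* (k :+ k)))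
           refl (ν (suc m ℕ.* n)) μ κ ⟩
    ν (suc m ℕ.* n) * (μ * (κ + κ))      ≡⟨ mn-inverse ⟩
    1ℚ                                   ∎

  2d/m : ∀ d → (+ 2 ℤ.* + d) / suc m ≡ 2ℚ * ν d * μ
  2d/m d = trans (/-as-*-inverse (+ 2 ℤ.* + d) (suc m) mμ≡1) (cong (_* μ) (trans (ι-* (+ 2) (+ d)) (cong (_* ν d) ι-2)))

  -- Each petal is crossed completely, along two edges of the cycle.
  hub-hub-value : ∀ d → hub-hub d ≡ μ * (ν (twice d) - ν (twice d) * ν (twice d) * κ)
  hub-hub-value d = begin
    hub-hub d
      ≡⟨ /-as-*-inverse (+ 2 ℤ.* + d ℤ.* (+ n ℤ.- + d)) (suc m ℕ.* n) {{mn≢0}} mn-inverse ⟩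
    ι (+ 2 ℤ.* + d ℤ.* (+ n ℤ.- + d)) * (μ * (κ + κ))
      ≡⟨ cong (_* (μ * (κ + κ))) (trans (ι-* (+ 2 ℤ.* + d) (+ n ℤ.- + d))
           (cong₂ _*_ (trans (ι-* (+ 2) (+ d)) (cong (_* ν d) ι-2)) (ι-- (+ n) (+ d)))) ⟩
    2ℚ * ν d * (ν n - ν d) * (μ * (κ + κ))
      ≡⟨ solve 4 (λ d N r k → (con 1ℚ :+ con 1ℚ) :* d :* (N :- d) :* (r :* (k :+ k))
           := r :* ((d :+ d) :* (N :* (k :+ k)) :- (d :+ d) :* (d :+ d) :* k)) refl (ν d) (ν n) μ κ ⟩
    μ * ((ν d + ν d) * (ν n * (κ + κ)) - (ν d + ν d) * (ν d + ν d) * κ)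
      ≡⟨ cong (λ s → μ * ((ν d + ν d) * s - (ν d + ν d) * (ν d + ν d) * κ)) n2κ≡1 ⟩
    μ * ((ν d + ν d) * 1ℚ - (ν d + ν d) * (ν d + ν d) * κ)
      ≡⟨ cong (λ s → μ * (s - (ν d + ν d) * (ν d + ν d) * κ)) (ℚ.*-identityʳ (ν d + ν d)) ⟩
    μ * ((ν d + ν d) - (ν d + ν d) * (ν d + ν d) * κ)
      ≡⟨ cong (λ D → μ * (D - D * D * κ)) (ν-twice d) ⟨
    μ * (ν (twice d) - ν (twice d) * ν (twice d) * κ) ∎

  -- One end stops at the centre of its petal, which leaves 2d - 1 = 2e + 1 edges of the cycle and
  -- adds one leg.
  hub-inner-value : ∀ e → hub-inner (suc e) ≡ μ * (1ℚ + (ν (suc (twice e)) - ν (suc (twice e)) * ν (suc (twice e)) * κ))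
  hub-inner-value e = begin
    hub-inner (suc e)
      ≡⟨ cong₂ _-_ (2d/m (suc e)) (/-as-*-inverse ((+ 2 ℤ.* + suc e ℤ.- + 1) ℤ.^ 2) (2 ℕ.* suc m ℕ.* n) {{2mn≢0}} 2mn-inverse) ⟩
    2ℚ * ν (suc e) * μ - ι ((+ 2 ℤ.* + suc e ℤ.- + 1) ℤ.^ 2) * (μ * κ)
      ≡⟨ cong (λ s → 2ℚ * ν (suc e) * μ - s * (μ * κ)) (trans (ι-square (+ 2 ℤ.* + suc e ℤ.- + 1)) (cong (λ s → s * s)
           (trans (ι-- (+ 2 ℤ.* + suc e) (+ 1)) (cong₂ _-_ (trans (ι-* (+ 2) (+ suc e)) (cong (_* ν (suc e)) ι-2)) ι-1)))) ⟩
    2ℚ * ν (suc e) * μ - (2ℚ * ν (suc e) - 1ℚ) * (2ℚ * ν (suc e) - 1ℚ) * (μ * κ)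
      ≡⟨ cong (λ d → 2ℚ * d * μ - (2ℚ * d - 1ℚ) * (2ℚ * d - 1ℚ) * (μ * κ)) (ν-suc e) ⟩
    2ℚ * (1ℚ + ν e) * μ - (2ℚ * (1ℚ + ν e) - 1ℚ) * (2ℚ * (1ℚ + ν e) - 1ℚ) * (μ * κ)
      ≡⟨ solve 3 (λ e r k → (con 1ℚ :+ con 1ℚ) :* (con 1ℚ :+ e) :* r :- ((con 1ℚ :+ con 1ℚ) :* (con 1ℚ :+ e) :- con 1ℚ) :* ((con 1ℚ :+ con 1ℚ) :* (con 1ℚ :+ e) :- con 1ℚ) :* (r :* k)
           := r :* (con 1ℚ :+ ((con 1ℚ :+ (e :+ e)) :- (con 1ℚ :+ (e :+ e)) :* (con 1ℚ :+ (e :+ e)) :* k))) refl (ν e) μ κ ⟩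
    μ * (1ℚ + ((1ℚ + (ν e + ν e)) - (1ℚ + (ν e + ν e)) * (1ℚ + (ν e + ν e)) * κ))
      ≡⟨ cong (λ D → μ * (1ℚ + (D - D * D * κ))) (trans (ν-suc (twice e)) (cong (λ s → 1ℚ + s) (ν-twice e))) ⟨
    μ * (1ℚ + (ν (suc (twice e)) - ν (suc (twice e)) * ν (suc (twice e)) * κ)) ∎

  -- Both ends stop at centres, which leaves 2d - 2 = 2e edges of the cycle and adds two legs.
  inner-inner-value : ∀ e → inner-inner (suc e) ≡ μ * (1ℚ + 1ℚ + (ν (twice e) - ν (twice e) * ν (twice e) * κ))
  inner-inner-value e = begin
    inner-inner (suc e)
      ≡⟨ cong₂ _-_ (2d/m (suc e)) (/-as-*-inverse (+ 2 ℤ.* (+ suc e ℤ.- + 1) ℤ.^ 2) (suc m ℕ.* n) {{mn≢0}} mn-inverse) ⟩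
    2ℚ * ν (suc e) * μ - ι (+ 2 ℤ.* (+ suc e ℤ.- + 1) ℤ.^ 2) * (μ * (κ + κ))
      -- The difference `+ suc e ℤ.- + 1` computes to `+ e`.
      ≡⟨ cong₂ (λ d s → 2ℚ * d * μ - s * (μ * (κ + κ))) (ν-suc e)
           (trans (ι-* (+ 2) ((+ e) ℤ.^ 2)) (cong₂ _*_ ι-2 (ι-square (+ e)))) ⟩
    2ℚ * (1ℚ + ν e) * μ - 2ℚ * (ν e * ν e) * (μ * (κ + κ))
      ≡⟨ solve 3 (λ e r k → (con 1ℚ :+ con 1ℚ) :* (con 1ℚ :+ e) :* r :- (con 1ℚ :+ con 1ℚ) :* (e :* e) :* (r :* (k :+ k))
           := r :* (con 1ℚ :+ con 1ℚ :+ ((e :+ e) :- (e :+ e) :* (e :+ e) :* k))) refl (ν e) μ κ ⟩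
    μ * (1ℚ + 1ℚ + ((ν e + ν e) - (ν e + ν e) * (ν e + ν e) * κ))
      ≡⟨ cong (λ D → μ * (1ℚ + 1ℚ + (D - D * D * κ))) (ν-twice e) ⟨
    μ * (1ℚ + 1ℚ + (ν (twice e) - ν (twice e) * ν (twice e) * κ)) ∎

  -- The third formula must exclude equal vertices: an inner vertex has an arc with d = 1 to itself,
  -- for which the formula gives 2/m instead of 0.
  Formulas : (u v : Vertex) → ℕ → Set
  Formulas u v d =
      (Associated u × Associated v → resistance u v ≡ hub-hub d)
    × ((Associated u × ¬ Associated v) ⊎ (¬ Associated u × Associated v) → resistance u v ≡ hub-inner d)
    × (¬ Associated u × ¬ Associated v → u ≢ v → resistance u v ≡ inner-inner d)

  Formulas-sym : ∀ u v d → Formulas u v d → Formulas v u d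
  Formulas-sym u v d (both , one , none) =
      (λ (a , b) → trans (resistance-sym v u) (both (b , a)))
    , (λ { (inj₁ (a , b)) → trans (resistance-sym v u) (one (inj₂ (b , a)))
         ; (inj₂ (a , b)) → trans (resistance-sym v u) (one (inj₁ (b , a))) })
    , (λ (a , b) v≢u → trans (resistance-sym v u) (none (b , a) (≢-sym v≢u)))

  formulas-refl : ∀ u → Formulas u u 0
  formulas-refl u =
      (λ _ → trans (resistance-refl u) (sym (trans (hub-hub-value 0) (trans (cong (λ D → μ * (D - D * D * κ)) ι-0)
        (solve 2 (λ r k → r :* (con 0ℚ :- con 0ℚ :* con 0ℚ :* k) := con 0ℚ) refl μ κ)))))
    , (λ { (inj₁ (a , ¬a)) → contradiction a ¬a ; (inj₂ (¬a , a)) → contradiction a ¬a })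
    , (λ _ u≢u → contradiction refl u≢u)

  formulas-arc : ∀ {u v d} → Arc u v d → Formulas u v d
  formulas-arc (s , t , (k , k≢x , refl) , (l , l≢y , refl) , refl) with petalCount-steps s t
  ... | e , count , steps = subst (Formulas (glue s k) (glue t l)) (sym count) (cases (kind k) (kind l) k≢x l≢y)
    where
    arc : ∀ {k l a b} → k ≢ x → l ≢ y → h k ≡ a → h l ≡ b → h k * δ (glue s k) (glue t l) ≡ 0ℚ →
          ∀ D → D ℕ.+ level k ≡ level l ℕ.+ twice e →
          resistance (glue s k) (glue t l) ≡ μ * (a + b + (ν D - ν D * ν D * κ))
    arc {k} {l} k≢x l≢y refl refl hδ≡0 D eq = arc-resistance k≢x l≢y hδ≡0 D (around s t k l e D eq steps)

    hδ-hub : ∀ w → h y * δ (glue s y) w ≡ 0ℚ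
    hδ-hub w = trans (cong (_* δ (glue s y) w) h-y) (ℚ.*-zeroˡ (δ (glue s y) w))

    hδ-≢ : ∀ {k w} → glue s k ≢ w → h k * δ (glue s k) w ≡ 0ℚ
    hδ-≢ {k} {w} ≢w = trans (cong (h k *_) (ind-no (glue s k ≟ w) ≢w)) (ℚ.*-zeroʳ (h k))

    cases : ∀ {k l} → Kind k → Kind l → k ≢ x → l ≢ y → Formulas (glue s k) (glue t l) (suc e)
    cases isx _   k≢x _   = contradiction refl k≢x
    cases _   isy _   l≢y = contradiction refl l≢y
    -- The levels 0 and 2 give 2e + 2 edges. A full turn from an associated vertex to itself falls
    -- under this case, with 2n edges and resistance 0.
    cases isy isx k≢x l≢y =
        (λ _ → trans (arc k≢x l≢y h-y h-x (hδ-hub _) (twice (suc e))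
                       (trans (cong (twice (suc e) ℕ.+_) level-y) (trans (ℕ.+-identityʳ _) (cong (ℕ._+ twice e) (sym level-x)))))
                (trans (cong (μ *_) (trans
                         (cong (_+ (ν (twice (suc e)) - ν (twice (suc e)) * ν (twice (suc e)) * κ)) (ℚ.+-identityʳ 0ℚ)) (ℚ.+-identityˡ _)))
                       (sym (hub-hub-value (suc e)))))
      , (λ { (inj₁ (_ , ¬a)) → contradiction (t , refl) ¬a ; (inj₂ (¬a , _)) → contradiction (associated-y s) ¬a })
      , (λ (¬a , _) → contradiction (associated-y s) ¬a)
    cases isy (inner l≢x _) k≢x l≢y =
        (λ (_ , a) → contradiction a (¬associated-inner l≢x l≢y))
      , (λ _ → trans (arc k≢x l≢y h-y (h-inner l≢x l≢y) (hδ-hub _) (suc (twice e))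
                       (trans (cong (suc (twice e) ℕ.+_) level-y) (trans (ℕ.+-identityʳ _) (cong (ℕ._+ twice e) (sym (level-inner l≢x l≢y))))))
                (sym (hub-inner-value e)))
      , (λ (¬a , _) → contradiction (associated-y s) ¬a)
    cases (inner _ k≢y) isx k≢x l≢y =
        (λ (a , _) → contradiction a (¬associated-inner k≢x k≢y))
      , (λ _ → trans (arc k≢x l≢y (h-inner k≢x k≢y) h-x (hδ-≢ (λ eq → ¬associated-inner k≢x k≢y (t , sym eq))) (suc (twice e))
                       (trans (cong (suc (twice e) ℕ.+_) (level-inner k≢x k≢y)) (trans (ℕ.+-comm (suc (twice e)) 1) (cong (ℕ._+ twice e) (sym level-x)))))
                (sym (hub-inner-value e)))
      , (λ (_ , ¬a) → contradiction (t , refl) ¬a)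
    cases (inner _ k≢y) (inner l≢x _) k≢x l≢y =
        (λ (a , _) → contradiction a (¬associated-inner k≢x k≢y))
      , (λ { (inj₁ (a , _)) → contradiction a (¬associated-inner k≢x k≢y) ; (inj₂ (_ , a)) → contradiction a (¬associated-inner l≢x l≢y) })
      , (λ _ u≢v → trans (arc k≢x l≢y (h-inner k≢x k≢y) (h-inner l≢x l≢y) (hδ-≢ u≢v) (twice e)
                       (trans (cong (twice e ℕ.+_) (level-inner k≢x k≢y)) (trans (ℕ.+-comm (twice e) 1) (cong (ℕ._+ twice e) (sym (level-inner l≢x l≢y))))))
                (sym (inner-inner-value e)))

  formulas : ∀ u v d → Separating u v d → Formulas u v d
  formulas u _ _ (inj₁ (refl , refl)) = formulas-refl u
  formulas u v d (inj₂ (inj₁ arc))    = formulas-arc arc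
  formulas u v d (inj₂ (inj₂ arc))    = Formulas-sym v u d (formulas-arc arc)

theorem4p3 : ∀ (m n : ℕ) .{{_ : NonZero m}} .{{_ : NonZero n}} → 3 ≤ m → 3 ≤ n →
  ∀ (x y : Fin m) (x≢y : x ≢ y) →
  let open Flower (complete m) n x y x≢y
      r[_,_]≡_ = IsResistanceDistance flower
      mn≢0 = m*n≢0 m n
      2mn≢0 = m*n≢0 (2 ℕ.* m) n {{m*n≢0 2 m}}
  in
  ∀ (u v : Vertex) (d : ℕ) → Separating u v d →
    (Associated u × Associated v →
      r[ u , v ]≡ ((+ 2 ℤ.* + d ℤ.* (+ n ℤ.- + d)) / (m ℕ.* n)) {{mn≢0}})
  × ((Associated u × ¬ Associated v) ⊎ (¬ Associated u × Associated v) →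
      r[ u , v ]≡ ((+ 2 ℤ.* + d) / m
                   - (((+ 2 ℤ.* + d ℤ.- + 1) ℤ.^ 2) / (2 ℕ.* m ℕ.* n)) {{2mn≢0}}))
  × (¬ Associated u × ¬ Associated v → u ≢ v →
      r[ u , v ]≡ ((+ 2 ℤ.* + d) / m
                   - ((+ 2 ℤ.* (+ d ℤ.- + 1) ℤ.^ 2) / (m ℕ.* n)) {{mn≢0}}))
theorem4p3 M@(suc (suc m)) n@(suc (suc (suc n′))) (s≤s (s≤s _)) (s≤s (s≤s (s≤s _))) x y x≢y u v d separating =
  let both , one , none = formulas u v d separating in
    (λ uv → isResistanceDistance u v (both uv))
  , (λ uv → isResistanceDistance u v (one uv))
  , (λ uv u≢v → isResistanceDistance u v (none uv u≢v))
  where open FlowerGreen (suc m) n′ x y x≢y (+ 1 / M) (+ 1 / (twice n)) (n*1/n≡1 M) (n*1/n≡1 (twice n))
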